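{- (ZF, without the Axiom of Choice.) For each uncountable cardinal $\kappa\in On$, both $Free(\kappa\mapsto[\kappa]^{<\omega},\omega)$ and $FreeUnion(\kappa\mapsto[\kappa]^{<\omega},\omega)$ hold.
   Context: The base theory is ZF. Cardinals are initial ordinals. Given a set mapping $F:\kappa\to[\kappa]^{<\mu}$, a set $X\subset\kappa$ is called $F$-free iff $\alpha\notin F(\beta)$ for each $\{\alpha,\beta\}\in[X]^2$ (that is, for any two distinct $\alpha,\beta\in X$). For cardinals $\kappa,\lambda,\mu$: $Free(\kappa\mapsto[\kappa]^{<\mu},\lambda)$ means that for each set mapping $F:\kappa\to[\kappa]^{<\mu}$ there is an $F$-free set $A\subset\kappa$ with $|A|=\lambda$; $FreeUnion(\kappa\mapsto[\kappa]^{<\mu},\lambda)$ means that for each set mapping $F:\kappa\to[\kappa]^{<\mu}$ the set $\kappa$ can be partitioned into $\lambda$-many $F$-free sets. -}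

module Defs where

open import Level using (suc)
open import Data.Nat.Base using (ℕ; _+_)
open import Data.Fin.Base using (Fin)
open import Data.Fin.Patterns using (0F; 1F; 2F)
open import Data.Vec.Base using (Vec; []; _∷_; lookup)
open import Data.Product.Base using (_×_; _,_; ∃; proj₁; proj₂)
open import Data.Sum.Base using (_⊎_)
open import Function.Bundles using (_⇔_; mk⇔; Equivalence)
open import Relation.Nullary.Negation.Core using (¬_; contradiction)
open import Relation.Binary.PropositionalEquality.Core using (_≡_; _≢_; subst)

-- First-order formulas in the language {∈, =}, with free variables (de Bruijn
-- indices) in Fin n.  The schemas of ZF below range over these formulas only.
-- Letting them range over all Agda predicates V → Set ℓ instead would leak
-- choice into the model, since ∃ in Agda comes with a choice of witness.

infix  8 _∈̇_ _≐_
infix  7 ¬̇_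
infixr 6 _∧̇_
infixr 5 _∨̇_
infixr 4 _⇒̇_
infix  3 _⇔̇_

data Formula : ℕ → Set where
  _∈̇_ _≐_             : ∀ {n} → Fin n → Fin n → Formula n
  ¬̇_                  : ∀ {n} → Formula n → Formula n
  _∧̇_ _∨̇_ _⇒̇_ _⇔̇_ : ∀ {n} → Formula n → Formula n → Formula n
  ∀̇ ∃̇                : ∀ {n} → Formula (1 + n) → Formula n

module Semantics {ℓ} (V : Set ℓ) (_∈_ : V → V → Set ℓ) where

  infix 4 _⊆_

  Sat : ∀ {n} → Vec V n → Formula n → Set ℓ
  Sat ρ (i ∈̇ j)  = lookup ρ i ∈ lookup ρ j
  Sat ρ (i ≐ j)   = lookup ρ i ≡ lookup ρ j
  Sat ρ (¬̇ φ)    = ¬ Sat ρ φ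
  Sat ρ (φ ∧̇ ψ)  = Sat ρ φ × Sat ρ ψ
  Sat ρ (φ ∨̇ ψ)  = Sat ρ φ ⊎ Sat ρ ψ
  Sat ρ (φ ⇒̇ ψ)  = Sat ρ φ → Sat ρ ψ
  Sat ρ (φ ⇔̇ ψ)  = Sat ρ φ ⇔ Sat ρ ψ
  Sat ρ (∀̇ φ)    = ∀ x → Sat (x ∷ ρ) φ
  Sat ρ (∃̇ φ)    = ∃ λ x → Sat (x ∷ ρ) φ

  _⊆_ : V → V → Set ℓ
  x ⊆ y = ∀ z → z ∈ x → z ∈ y

  IsEmpty : V → Set ℓ
  IsEmpty e = ∀ z → ¬ (z ∈ e)

  -- s = x ∪ {x}
  IsSuccessor : V → V → Set ℓ
  IsSuccessor s x = ∀ z → (z ∈ s) ⇔ (z ∈ x ⊎ z ≡ x)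

  Inductive : V → Set ℓ
  Inductive w = (∃ λ e → e ∈ w × IsEmpty e)
              × (∀ x → x ∈ w → ∃ λ s → s ∈ w × IsSuccessor s x)

-- A model of ZF whose equality is interpreted by _≡_.

record ZF ℓ : Set (suc ℓ) where
  infix 4 _∈_
  field
    V   : Set ℓ
    _∈_ : V → V → Set ℓ

  open Semantics V _∈_ public

  field
    extensionality : ∀ x y → (∀ z → (z ∈ x) ⇔ (z ∈ y)) → x ≡ y
    foundation     : ∀ x → (∃ λ y → y ∈ x) →
                     ∃ λ y → y ∈ x × (∀ z → z ∈ x → ¬ (z ∈ y))
    pairing        : ∀ x y → ∃ λ p → ∀ z → (z ∈ p) ⇔ (z ≡ x ⊎ z ≡ y)
    union          : ∀ x → ∃ λ u → ∀ z → (z ∈ u) ⇔ (∃ λ y → y ∈ x × z ∈ y)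
    powerset       : ∀ x → ∃ λ p → ∀ z → (z ∈ p) ⇔ (z ⊆ x)
    infinity       : ∃ λ w → Inductive w
    separation     : ∀ {n} (φ : Formula (1 + n)) (ρ : Vec V n) a →
                     ∃ λ b → ∀ x → (x ∈ b) ⇔ (x ∈ a × Sat (x ∷ ρ) φ)
    replacement    : ∀ {n} (φ : Formula (2 + n)) (ρ : Vec V n) a →
                     (∀ x → x ∈ a → ∀ y z →
                        Sat (x ∷ y ∷ ρ) φ → Sat (x ∷ z ∷ ρ) φ → y ≡ z) →
                     ∃ λ b → ∀ y → (y ∈ b) ⇔ (∃ λ x → x ∈ a × Sat (x ∷ y ∷ ρ) φ)

-- All notions below are internal to the model 𝓜: functions, bijections,
-- partitions and so on are elements of V.

module SetTheory {ℓ} (𝓜 : ZF ℓ) where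
  open ZF 𝓜

  infix 4 _≈_ _∈[_]^<_

  pair : V → V → V
  pair x y = proj₁ (pairing x y)

  ⟨_,_⟩ : V → V → V
  ⟨ x , y ⟩ = pair (pair x x) (pair x y)

  isInductive : ∀ {n} → Formula (1 + n)
  isInductive = ∃̇ (0F ∈̇ 1F ∧̇ ∀̇ (¬̇ 0F ∈̇ 1F))
              ∧̇ ∀̇ (0F ∈̇ 1F ⇒̇
                   ∃̇ (0F ∈̇ 2F ∧̇ ∀̇ (0F ∈̇ 1F ⇔̇ 0F ∈̇ 2F ∨̇ 0F ≐ 2F)))

  ω-exists : ∃ λ w → Inductive w × (∀ v → Inductive v → w ⊆ v)
  ω-exists = w , (empty∈w , successor∈w) , λ v v-ind z z∈w → proj₂ (to (spec z) z∈w) v v-ind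
    where
    open Equivalence
    I     = proj₁ infinity
    I-ind = proj₂ infinity
    W     = separation (∀̇ (isInductive ⇒̇ 1F ∈̇ 0F)) [] I
    w     = proj₁ W

    spec : ∀ x → (x ∈ w) ⇔ (x ∈ I × (∀ v → Inductive v → x ∈ v))
    spec = proj₂ W

    empty-unique : ∀ {e e′} → IsEmpty e → IsEmpty e′ → e ≡ e′
    empty-unique p q = extensionality _ _ λ z →
      mk⇔ (λ z∈e → contradiction z∈e (p z)) (λ z∈e′ → contradiction z∈e′ (q z))

    successor-unique : ∀ {s s′ x} → IsSuccessor s x → IsSuccessor s′ x → s ≡ s′
    successor-unique p q = extensionality _ _ λ z →
      mk⇔ (λ z∈s → from (q z) (to (p z) z∈s)) (λ z∈s′ → from (p z) (to (q z) z∈s′))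

    empty∈w : ∃ λ e → e ∈ w × IsEmpty e
    empty∈w with proj₁ I-ind
    ... | e , e∈I , e-empty = e , from (spec e) (e∈I , in-all) , e-empty
      where
      in-all : ∀ v → Inductive v → e ∈ v
      in-all v ((e′ , e′∈v , e′-empty) , _) =
        subst (_∈ v) (empty-unique e′-empty e-empty) e′∈v

    successor∈w : ∀ x → x ∈ w → ∃ λ s → s ∈ w × IsSuccessor s x
    successor∈w x x∈w with to (spec x) x∈w
    ... | x∈I , x∈all with proj₂ I-ind x x∈I
    ... | s , s∈I , s-succ = s , from (spec s) (s∈I , in-all) , s-succ
      where
      in-all : ∀ v → Inductive v → s ∈ v
      in-all v v-ind with proj₂ v-ind x (x∈all v v-ind)
      ... | s′ , s′∈v , s′-succ = subst (_∈ v) (successor-unique s′-succ s-succ) s′∈v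

  ω : V
  ω = proj₁ ω-exists

  -- The codomain is a class, so that [κ]^{<μ} can be used without first
  -- forming it as a set.
  IsFunction : V → V → (V → Set ℓ) → Set ℓ
  IsFunction f a B =
      (∀ p → p ∈ f → ∃ λ x → ∃ λ y → x ∈ a × B y × p ≡ ⟨ x , y ⟩)
    × (∀ x → x ∈ a → ∃ λ y → ⟨ x , y ⟩ ∈ f × (∀ z → ⟨ x , z ⟩ ∈ f → z ≡ y))

  IsInjection : V → V → V → Set ℓ
  IsInjection f a b =
      IsFunction f a (_∈ b)
    × (∀ x x′ y → ⟨ x , y ⟩ ∈ f → ⟨ x′ , y ⟩ ∈ f → x ≡ x′)

  IsBijection : V → V → V → Set ℓ
  IsBijection f a b =
      IsInjection f a b
    × (∀ y → y ∈ b → ∃ λ x → x ∈ a × ⟨ x , y ⟩ ∈ f)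

  _≈_ : V → V → Set ℓ
  a ≈ b = ∃ λ f → IsBijection f a b

  Uncountable : V → Set ℓ
  Uncountable a = ¬ (∃ λ f → IsInjection f a ω)

  Ordinal : V → Set ℓ
  Ordinal α =
      (∀ x → x ∈ α → x ⊆ α)
    × (∀ x → x ∈ α → ¬ (x ∈ x))
    × (∀ x y z → x ∈ α → y ∈ α → z ∈ α → x ∈ y → y ∈ z → x ∈ z)
    × (∀ x y → x ∈ α → y ∈ α → x ∈ y ⊎ x ≡ y ⊎ y ∈ x)
    × (∀ s → s ⊆ α → (∃ λ x → x ∈ s) →
         ∃ λ m → m ∈ s × (∀ x → x ∈ s → m ≡ x ⊎ m ∈ x))

  Cardinal : V → Set ℓ
  Cardinal κ = Ordinal κ × (∀ α → α ∈ κ → ¬ (α ≈ κ))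

  -- |x| = ν
  HasCardinality : V → V → Set ℓ
  HasCardinality x ν = Cardinal ν × x ≈ ν

  -- x ∈ [κ]^{<μ}
  _∈[_]^<_ : V → V → V → Set ℓ
  x ∈[ κ ]^< μ = x ⊆ κ × (∃ λ ν → HasCardinality x ν × ν ∈ μ)

  IsSetMapping : V → V → V → Set ℓ
  IsSetMapping F κ μ = IsFunction F κ (_∈[ κ ]^< μ)

  IsFree : V → V → Set ℓ
  IsFree F X = ∀ α β → α ∈ X → β ∈ X → α ≢ β → ∀ y → ⟨ β , y ⟩ ∈ F → ¬ (α ∈ y)

  IsPartition : V → V → Set ℓ
  IsPartition P a =
      (∀ X → X ∈ P → X ⊆ a × (∃ λ x → x ∈ X))
    × (∀ x → x ∈ a → ∃ λ X → X ∈ P × x ∈ X)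
    × (∀ X Y → X ∈ P → Y ∈ P → (∃ λ x → x ∈ X × x ∈ Y) → X ≡ Y)

  -- Free(κ ↦ [κ]^{<μ}, ν)
  Free : V → V → V → Set ℓ
  Free κ μ ν = ∀ F → IsSetMapping F κ μ →
    ∃ λ A → A ⊆ κ × IsFree F A × HasCardinality A ν

  -- FreeUnion(κ ↦ [κ]^{<μ}, ν)
  FreeUnion : V → V → V → Set ℓ
  FreeUnion κ μ ν = ∀ F → IsSetMapping F κ μ →
    ∃ λ P → IsPartition P κ × (∀ X → X ∈ P → IsFree F X) × HasCardinality P ν

{-# OPTIONS --safe #-}
module Submission where

-- Join α and β when α ∈ F(β).  For each β let ξ be the least ordinal from which
-- β can be reached by iterating F, and n the least number of steps needed.  The
-- points with a given ξ and n form a finite set, so ordering the points with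
-- the same ξ by n and then by ∈ gives every β finitely many predecessors; along
-- an edge α ∈ F(β), ξ cannot increase from β to α.  Hence the edges are covered
-- by a well-founded relation with finite predecessor sets (same ξ and earlier,
-- or smaller ξ and joined), and its ω-valued rank is a proper colouring of the
-- graph.  No choice is involved, since everything is defined from F and the
-- order of κ.  If infinitely many points are joined pairwise beforehand, all of
-- ω occurs as a colour, and the colour classes are the required partition.
-- Some class is infinite, as otherwise the order by colour and then by ∈ would
-- have type ω and κ would be countable.

open import Axiom.DoubleNegationElimination using (em⇒dne)
open import Axiom.ExcludedMiddle using (ExcludedMiddle)
open import Data.Empty using (⊥-elim)
open import Data.Fin.Base using (Fin; zero; suc; _↑ˡ_; _↑ʳ_; lift)
open import Data.Fin.Patterns using (0F; 1F; 2F)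
open import Data.Nat.Base using (ℕ; _+_)
open import Data.Product.Base using (_×_; _,_; ∃; proj₁; proj₂)
open import Data.Product.Function.NonDependent.Propositional using (_×-⇔_)
open import Data.Sum.Base using (_⊎_; inj₁; inj₂; [_,_]′)
open import Data.Sum.Function.Propositional using (_⊎-⇔_)
open import Data.Vec.Base using (Vec; []; _∷_; _++_; lookup)
open import Data.Vec.Properties using (lookup-++ˡ; lookup-++ʳ)
open import Function.Base using (id; _∘_)
open import Function.Bundles using (_⇔_; mk⇔; Equivalence)
open import Function.Construct.Composition using (_⇔-∘_)
open import Function.Related.TypeIsomorphisms using (→-cong-⇔; ¬-cong-⇔)
open import Relation.Binary.PropositionalEquality.Core
  using (_≡_; _≢_; refl; sym; trans; cong; subst; subst₂)
open import Relation.Nullary.Decidable.Core using (yes; no)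
open import Relation.Nullary.Negation.Core using (¬_; contradiction)
open import Defs

open Equivalence using (to; from)

-- Formulas with parameters and unordered-pair terms

module Classes {ℓ} (𝓜 : ZF ℓ) where
  open ZF 𝓜
  open SetTheory 𝓜 using (pair; ⟨_,_⟩)

  infix  8 _∊_ _≃_
  infix  7 ∼_
  infixr 6 _∧_
  infixr 5 _∨_
  infixr 4 _⊃_

  data Term (n : ℕ) : Set ℓ where
    var : Fin n → Term n
    con : V → Term n
    pr  : Term n → Term n → Term n

  pattern v₀ = var zero
  pattern v₁ = var (suc zero)
  pattern v₂ = var (suc (suc zero))
  pattern v₃ = var (suc (suc (suc zero)))
  pattern v₄ = var (suc (suc (suc (suc zero))))
  pattern v₅ = var (suc (suc (suc (suc (suc zero)))))
  pattern v₆ = var (suc (suc (suc (suc (suc (suc zero))))))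

  ⟪_,_⟫ : ∀ {n} → Term n → Term n → Term n
  ⟪ s , t ⟫ = pr (pr s s) (pr s t)

  data Class (n : ℕ) : Set ℓ where
    _∊_ _≃_     : Term n → Term n → Class n
    ∼_          : Class n → Class n
    _∧_ _∨_ _⊃_ : Class n → Class n → Class n
    ∀∙ ∃∙       : Class (1 + n) → Class n

  eval : ∀ {n} → Vec V n → Term n → V
  eval ρ (var i)  = lookup ρ i
  eval ρ (con c)  = c
  eval ρ (pr s t) = pair (eval ρ s) (eval ρ t)

  Holds : ∀ {n} → Vec V n → Class n → Set ℓ
  Holds ρ (s ∊ t) = eval ρ s ∈ eval ρ t
  Holds ρ (s ≃ t) = eval ρ s ≡ eval ρ t
  Holds ρ (∼ φ)   = ¬ Holds ρ φ
  Holds ρ (φ ∧ ψ) = Holds ρ φ × Holds ρ ψ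
  Holds ρ (φ ∨ ψ) = Holds ρ φ ⊎ Holds ρ ψ
  Holds ρ (φ ⊃ ψ) = Holds ρ φ → Holds ρ ψ
  Holds ρ (∀∙ φ)  = ∀ x → Holds (x ∷ ρ) φ
  Holds ρ (∃∙ φ)  = ∃ λ x → Holds (x ∷ ρ) φ

  -- Translation of classes into first-order formulas

  Agree : ∀ {m n} → Vec V m → (Fin n → Fin m) → Vec V n → Set ℓ
  Agree τ f ρ = ∀ i → lookup τ (f i) ≡ lookup ρ i

  agree-lift : ∀ {m n} {τ : Vec V m} {f : Fin n → Fin m} {ρ} x →
               Agree τ f ρ → Agree (x ∷ τ) (lift 1 f) (x ∷ ρ)
  agree-lift x A zero    = refl
  agree-lift x A (suc i) = A i

  agree-ˡ : ∀ {k l} {h : Fin (k + l) → V} (σ : Vec V k) (σ′ : Vec V l) →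
            (∀ i → h i ≡ lookup (σ ++ σ′) i) → ∀ i → h (i ↑ˡ l) ≡ lookup σ i
  agree-ˡ {l = l} σ σ′ A i = trans (A (i ↑ˡ l)) (lookup-++ˡ σ σ′ i)

  agree-ʳ : ∀ {k l} {h : Fin (k + l) → V} (σ : Vec V k) (σ′ : Vec V l) →
            (∀ i → h i ≡ lookup (σ ++ σ′) i) → ∀ i → h (k ↑ʳ i) ≡ lookup σ′ i
  agree-ʳ {k = k} σ σ′ A i = trans (A (k ↑ʳ i)) (lookup-++ʳ σ σ′ i)

  -- The formula is given in every larger context, so that translations of
  -- subterms with different parameters can be combined without a renaming
  -- lemma for formulas.
  record TermDefinition {n} (t : Vec V n → V) : Set ℓ where
    field
      {arity} : ℕ
      params  : Vec V arity
      formula : ∀ {m} → Fin m → (Fin n → Fin m) → (Fin arity → Fin m) → Formula m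
      correct : ∀ {m} {τ : Vec V m} i {f g ρ} → Agree τ f ρ → Agree τ g params →
                Sat τ (formula i f g) ⇔ lookup τ i ≡ t ρ

  record Definition {n} (P : Vec V n → Set ℓ) : Set ℓ where
    field
      {arity} : ℕ
      params  : Vec V arity
      formula : ∀ {m} → (Fin n → Fin m) → (Fin arity → Fin m) → Formula m
      correct : ∀ {m} {τ : Vec V m} {f g ρ} → Agree τ f ρ → Agree τ g params →
                Sat τ (formula f g) ⇔ P ρ

  pair-spec : ∀ {p x y} → (∀ z → (z ∈ p) ⇔ (z ≡ x ⊎ z ≡ y)) ⇔ p ≡ pair x y
  pair-spec {p} {x} {y} = mk⇔
    (λ h → extensionality _ _ λ z →
       mk⇔ (from (proj₂ (pairing x y) z) ∘ to (h z)) (from (h z) ∘ to (proj₂ (pairing x y) z)))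
    λ { refl → proj₂ (pairing x y) }

  -- The language has no function symbols, so a term is translated into the statement that a given
  -- variable is its value. Pairs quantify over the values of their two components, and constants
  -- become parameters.
  defineTerm : ∀ {n} (t : Term n) → TermDefinition (λ ρ → eval ρ t)
  defineTerm (var j) = record
    { params  = []
    ; formula = λ i f g → i ≐ f j
    ; correct = λ i A B → mk⇔ (λ e → trans e (A j)) (λ e → trans e (sym (A j))) }
  defineTerm (con c) = record
    { params  = c ∷ []
    ; formula = λ i f g → i ≐ g zero
    ; correct = λ i A B → mk⇔ (λ e → trans e (B zero)) (λ e → trans e (sym (B zero))) }
  defineTerm (pr s t) = record
    { params  = S.params ++ T.params
    ; formula = λ i f g →
        ∃̇ (∃̇ (S.formula 1F (suc ∘ suc ∘ f) (suc ∘ suc ∘ g ∘ (_↑ˡ _))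
             ∧̇ T.formula 0F (suc ∘ suc ∘ f) (suc ∘ suc ∘ g ∘ (S.arity ↑ʳ_))
             ∧̇ ∀̇ (0F ∈̇ suc (suc (suc i)) ⇔̇ 0F ≐ 2F ∨̇ 0F ≐ 1F)))
    ; correct = λ i A B → mk⇔
        (λ { (x , y , p , q , r) → trans (to pair-spec r)
               (trans (cong (λ u → pair u y) (to (S.correct 1F A (agree-ˡ S.params T.params B)) p))
                      (cong (pair _) (to (T.correct 0F A (agree-ʳ S.params T.params B)) q))) })
        (λ e → _ , _ , from (S.correct 1F A (agree-ˡ S.params T.params B)) refl
                     , from (T.correct 0F A (agree-ʳ S.params T.params B)) refl
                     , from pair-spec e) }
    where
    module S = TermDefinition (defineTerm s)
    module T = TermDefinition (defineTerm t)

  -- Atomic classes quantify over the values of their terms. Connectives concatenate the parameters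
  -- of both sides, and each side reads its own half through a renaming.
  define : ∀ {n} (φ : Class n) → Definition (λ ρ → Holds ρ φ)
  define (s ∊ t) = record
    { params  = S.params ++ T.params
    ; formula = λ f g →
        ∃̇ (∃̇ (S.formula 1F (suc ∘ suc ∘ f) (suc ∘ suc ∘ g ∘ (_↑ˡ _))
             ∧̇ T.formula 0F (suc ∘ suc ∘ f) (suc ∘ suc ∘ g ∘ (S.arity ↑ʳ_))
             ∧̇ 1F ∈̇ 0F))
    ; correct = λ A B → mk⇔
        (λ { (x , y , p , q , r) →
             subst₂ _∈_ (to (S.correct 1F A (agree-ˡ S.params T.params B)) p)
                        (to (T.correct 0F A (agree-ʳ S.params T.params B)) q) r })
        (λ e → _ , _ , from (S.correct 1F A (agree-ˡ S.params T.params B)) refl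
                     , from (T.correct 0F A (agree-ʳ S.params T.params B)) refl
                     , e) }
    where
    module S = TermDefinition (defineTerm s)
    module T = TermDefinition (defineTerm t)
  define (s ≃ t) = record
    { params  = S.params ++ T.params
    ; formula = λ f g → ∃̇ (S.formula 0F (suc ∘ f) (suc ∘ g ∘ (_↑ˡ _))
                          ∧̇ T.formula 0F (suc ∘ f) (suc ∘ g ∘ (S.arity ↑ʳ_)))
    ; correct = λ A B → mk⇔
        (λ { (x , p , q) → trans (sym (to (S.correct 0F A (agree-ˡ S.params T.params B)) p))
                                 (to (T.correct 0F A (agree-ʳ S.params T.params B)) q) })
        (λ e → _ , from (S.correct 0F A (agree-ˡ S.params T.params B)) refl
                 , from (T.correct 0F A (agree-ʳ S.params T.params B)) e) }
    where
    module S = TermDefinition (defineTerm s)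
    module T = TermDefinition (defineTerm t)
  define (∼ φ) = record
    { params  = D.params
    ; formula = λ f g → ¬̇ D.formula f g
    ; correct = λ A B → ¬-cong-⇔ (D.correct A B) }
    where module D = Definition (define φ)
  define (φ ∧ ψ) = record
    { params  = D.params ++ E.params
    ; formula = λ f g → D.formula f (g ∘ (_↑ˡ _)) ∧̇ E.formula f (g ∘ (D.arity ↑ʳ_))
    ; correct = λ A B → D.correct A (agree-ˡ D.params E.params B)
                  ×-⇔ E.correct A (agree-ʳ D.params E.params B) }
    where
    module D = Definition (define φ)
    module E = Definition (define ψ)
  define (φ ∨ ψ) = record
    { params  = D.params ++ E.params
    ; formula = λ f g → D.formula f (g ∘ (_↑ˡ _)) ∨̇ E.formula f (g ∘ (D.arity ↑ʳ_))
    ; correct = λ A B → D.correct A (agree-ˡ D.params E.params B)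
                  ⊎-⇔ E.correct A (agree-ʳ D.params E.params B) }
    where
    module D = Definition (define φ)
    module E = Definition (define ψ)
  define (φ ⊃ ψ) = record
    { params  = D.params ++ E.params
    ; formula = λ f g → D.formula f (g ∘ (_↑ˡ _)) ⇒̇ E.formula f (g ∘ (D.arity ↑ʳ_))
    ; correct = λ A B → →-cong-⇔ (D.correct A (agree-ˡ D.params E.params B))
                                 (E.correct A (agree-ʳ D.params E.params B)) }
    where
    module D = Definition (define φ)
    module E = Definition (define ψ)
  define (∀∙ φ) = record
    { params  = D.params
    ; formula = λ f g → ∀̇ (D.formula (lift 1 f) (suc ∘ g))
    ; correct = λ A B → mk⇔ (λ h x → to (D.correct (agree-lift x A) B) (h x))
                            (λ h x → from (D.correct (agree-lift x A) B) (h x)) }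
    where module D = Definition (define φ)
  define (∃∙ φ) = record
    { params  = D.params
    ; formula = λ f g → ∃̇ (D.formula (lift 1 f) (suc ∘ g))
    ; correct = λ A B → mk⇔ (λ { (x , h) → x , to (D.correct (agree-lift x A) B) h })
                            (λ { (x , h) → x , from (D.correct (agree-lift x A) B) h }) }
    where module D = Definition (define φ)

  opaque
    filter : Class 1 → V → V
    filter φ a = proj₁ (separation (D.formula (λ _ → zero) suc) D.params a)
      where module D = Definition (define φ)

    ∈-filter : ∀ {φ a x} → (x ∈ filter φ a) ⇔ (x ∈ a × Holds (x ∷ []) φ)
    ∈-filter {φ} {a} {x} =
      (mk⇔ id id ×-⇔ D.correct agree (λ _ → refl))
        ⇔-∘ proj₂ (separation (D.formula (λ _ → zero) suc) D.params a) x
      where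
      module D = Definition (define φ)
      agree : Agree (x ∷ D.params) (λ _ → zero) (x ∷ [])
      agree zero = refl

-- Pairs, unions, power sets and relations

module Sets {ℓ} (em : ExcludedMiddle ℓ) (𝓜 : ZF ℓ) where
  open ZF 𝓜
  open SetTheory 𝓜
  open Classes 𝓜

  dne : {P : Set ℓ} → ¬ ¬ P → P
  dne = em⇒dne em

  ∈-pair : ∀ {x y z} → (z ∈ pair x y) ⇔ (z ≡ x ⊎ z ≡ y)
  ∈-pair {x} {y} {z} = proj₂ (pairing x y) z

  ∈-pairˡ : ∀ {x y} → x ∈ pair x y
  ∈-pairˡ = from ∈-pair (inj₁ refl)

  ∈-pairʳ : ∀ {x y} → y ∈ pair x y
  ∈-pairʳ = from ∈-pair (inj₂ refl)

  ∈-singleton⁻ : ∀ {x z} → z ∈ pair x x → z ≡ x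
  ∈-singleton⁻ = [ id , id ]′ ∘ to ∈-pair

  pair-injectiveʳ : ∀ {a b c} → pair a b ≡ pair a c → b ≡ c
  pair-injectiveʳ {a} {b} {c} e with to ∈-pair (subst (b ∈_) e ∈-pairʳ)
  ... | inj₂ b≡c  = b≡c
  ... | inj₁ refl = sym (∈-singleton⁻ (subst (c ∈_) (sym e) ∈-pairʳ))

  ⟨⟩-injective : ∀ {a b c d} → ⟨ a , b ⟩ ≡ ⟨ c , d ⟩ → a ≡ c × b ≡ d
  ⟨⟩-injective {a} {b} {c} {d} e with a≡c
    where
    a≡c : a ≡ c
    a≡c with to ∈-pair (subst (pair a a ∈_) e ∈-pairˡ)
    ... | inj₁ p = ∈-singleton⁻ (subst (a ∈_) p ∈-pairˡ)
    ... | inj₂ p = sym (∈-singleton⁻ (subst (c ∈_) (sym p) ∈-pairˡ))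
  ... | refl = refl , pair-injectiveʳ (pair-injectiveʳ e)

  ⋃ : V → V
  ⋃ x = proj₁ (union x)

  ∈-⋃ : ∀ {x z} → (z ∈ ⋃ x) ⇔ (∃ λ y → y ∈ x × z ∈ y)
  ∈-⋃ {x} {z} = proj₂ (union x) z

  _∪_ : V → V → V
  a ∪ b = ⋃ (pair a b)

  ∈-∪ : ∀ {a b z} → (z ∈ a ∪ b) ⇔ (z ∈ a ⊎ z ∈ b)
  ∈-∪ {a} {b} {z} = mk⇔ split join
    where
    split : z ∈ a ∪ b → z ∈ a ⊎ z ∈ b
    split h with to ∈-⋃ h
    ... | y , y∈ , z∈y with to ∈-pair y∈
    ... | inj₁ refl = inj₁ z∈y
    ... | inj₂ refl = inj₂ z∈y
    join : z ∈ a ⊎ z ∈ b → z ∈ a ∪ b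
    join (inj₁ h) = from ∈-⋃ (a , ∈-pairˡ , h)
    join (inj₂ h) = from ∈-⋃ (b , ∈-pairʳ , h)

  𝒫 : V → V
  𝒫 x = proj₁ (powerset x)

  ∈-𝒫 : ∀ {x z} → (z ∈ 𝒫 x) ⇔ (z ⊆ x)
  ∈-𝒫 {x} {z} = proj₂ (powerset x) z

  ⟨⟩∈𝒫𝒫 : ∀ {a b x y} → x ∈ a → y ∈ b → ⟨ x , y ⟩ ∈ 𝒫 (𝒫 (a ∪ b))
  ⟨⟩∈𝒫𝒫 {a} {b} {x} {y} x∈a y∈b = from ∈-𝒫 λ s s∈ → from ∈-𝒫 λ z z∈s →
    case-s (to ∈-pair s∈) z∈s
    where
    x∈ = from (∈-∪ {a} {b}) (inj₁ x∈a)
    y∈ = from (∈-∪ {a} {b}) (inj₂ y∈b)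
    case-s : ∀ {s z} → s ≡ pair x x ⊎ s ≡ pair x y → z ∈ s → z ∈ a ∪ b
    case-s (inj₁ refl) z∈ with refl ← ∈-singleton⁻ z∈ = x∈
    case-s (inj₂ refl) z∈ with to ∈-pair z∈
    ... | inj₁ refl = x∈
    ... | inj₂ refl = y∈

  IsRelation : V → V → V → Set ℓ
  IsRelation R a b = ∀ p → p ∈ R → ∃ λ x → ∃ λ y → x ∈ a × y ∈ b × p ≡ ⟨ x , y ⟩

  module _ {R a b x y} (R-rel : IsRelation R a b) (xy∈R : ⟨ x , y ⟩ ∈ R) where

    domain : x ∈ a
    domain with R-rel _ xy∈R
    ... | _ , _ , x∈a , _ , e with refl , refl ← ⟨⟩-injective e = x∈a

    codomain : y ∈ b
    codomain with R-rel _ xy∈R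
    ... | _ , _ , _ , y∈b , e with refl , refl ← ⟨⟩-injective e = y∈b

  -- The third variable of φ, the pair itself, is a dummy that spares a
  -- weakening lemma for classes.
  opaque
    relation : Class 3 → V → V → V
    relation φ a b =
      filter (∃∙ (∃∙ (v₂ ≃ ⟪ v₀ , v₁ ⟫ ∧ v₀ ∊ con a ∧ v₁ ∊ con b ∧ φ))) (𝒫 (𝒫 (a ∪ b)))

    ∈-relation : ∀ {φ a b x y} → (⟨ x , y ⟩ ∈ relation φ a b) ⇔
                 (x ∈ a × y ∈ b × Holds (x ∷ y ∷ ⟨ x , y ⟩ ∷ []) φ)
    ∈-relation {φ} {a} {b} {x} {y} = mk⇔ out into
      where
      into : x ∈ a × y ∈ b × Holds (x ∷ y ∷ ⟨ x , y ⟩ ∷ []) φ → ⟨ x , y ⟩ ∈ relation φ a b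
      into (x∈a , y∈b , h) = from ∈-filter (⟨⟩∈𝒫𝒫 x∈a y∈b , _ , _ , refl , x∈a , y∈b , h)
      out : ⟨ x , y ⟩ ∈ relation φ a b → x ∈ a × y ∈ b × Holds (x ∷ y ∷ ⟨ x , y ⟩ ∷ []) φ
      out h with to ∈-filter h
      ... | _ , _ , _ , e , x∈a , y∈b , p with refl , refl ← ⟨⟩-injective e = x∈a , y∈b , p

    relation-isRelation : ∀ {φ a b} → IsRelation (relation φ a b) a b
    relation-isRelation p p∈ with to ∈-filter p∈
    ... | _ , y , x , e , x∈a , y∈b , _ = x , y , x∈a , y∈b , e

  _⊗_ : V → V → V
  a ⊗ b = relation (v₀ ≃ v₀) a b

  ∈-⊗ : ∀ {a b x y} → x ∈ a → y ∈ b → ⟨ x , y ⟩ ∈ a ⊗ b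
  ∈-⊗ x∈a y∈b = from ∈-relation (x∈a , y∈b , refl)

  -- Least fixed points of definable monotone operators

  module LeastFixedPoint (U : V) (Φ : V → V → Set ℓ) (φ : Class 3)
    (defines : ∀ S p x → Holds (p ∷ S ∷ x ∷ []) φ ⇔ Φ S p)
    (monotone : ∀ {S S′ p} → S ⊆ S′ → Φ S p → Φ S′ p) where

    opaque
      -- The intersection of all sets closed under `Φ` on `U`. Inside it `φ` sees the closed point,
      -- the set and, as its third variable, the point being filtered, which `defines` allows to be
      -- arbitrary.
      lfp : V
      lfp = filter (∀∙ (∀∙ (v₀ ∊ con U ⊃ φ ⊃ v₀ ∊ v₁) ⊃ v₁ ∊ v₀)) U

      lfp⊆ : lfp ⊆ U
      lfp⊆ p p∈ = proj₁ (to ∈-filter p∈)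

      lfp-least : ∀ S → (∀ p → p ∈ U → Φ S p → p ∈ S) → lfp ⊆ S
      lfp-least S closed p p∈ =
        proj₂ (to ∈-filter p∈) S λ q q∈U → closed q q∈U ∘ to (defines S q p)

      lfp-closed : ∀ {p} → p ∈ U → Φ lfp p → p ∈ lfp
      lfp-closed {p} p∈U h = from ∈-filter (p∈U , λ S closed →
        closed p p∈U (from (defines S p p) (monotone (lfp⊆S S closed) h)))
        where
        lfp⊆S : ∀ S → (∀ q → q ∈ U → Holds (q ∷ S ∷ p ∷ []) φ → q ∈ S) → lfp ⊆ S
        lfp⊆S S closed = lfp-least S λ q q∈U → closed q q∈U ∘ from (defines S q p)

      -- The points of `lfp` that satisfy `Φ lfp` already form a closed set, by monotonicity and
      -- `lfp-closed`, so minimality puts all of `lfp` into it.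
      lfp-unfold : ∀ {p} → p ∈ lfp → Φ lfp p
      lfp-unfold {p} p∈ with to ∈-filter (lfp-least unfolded closed p p∈)
        where
        unfolded : V
        -- The two quantifiers only place the point and `lfp` where `φ` expects them.
        unfolded = filter (∃∙ (∃∙ (v₀ ≃ v₂ ∧ v₁ ≃ con lfp ∧ φ))) lfp
        closed : ∀ q → q ∈ U → Φ unfolded q → q ∈ unfolded
        closed q q∈U h =
          from ∈-filter (lfp-closed q∈U Φlfp , lfp , q , refl , refl , from (defines lfp q q) Φlfp)
          where
          Φlfp : Φ lfp q
          Φlfp = monotone (λ r → proj₁ ∘ to ∈-filter) h
      ... | _ , _ , _ , refl , refl , h = to (defines lfp p p) h

  ∈-irrefl : ∀ {x} → ¬ (x ∈ x)
  ∈-irrefl {x} x∈x with foundation (pair x x) (x , ∈-pairˡ)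
  ... | m , m∈ , min with refl ← ∈-singleton⁻ m∈ = min m m∈ x∈x

  compare : ∀ {α x y} → Ordinal α → x ∈ α → y ∈ α → x ∈ y ⊎ x ≡ y ⊎ y ∈ x
  compare (_ , _ , _ , trichotomy , _) = trichotomy _ _

  -- ω

  ∅ : V
  ∅ = proj₁ (proj₁ (proj₁ (proj₂ ω-exists)))

  ∅∈ω : ∅ ∈ ω
  ∅∈ω = proj₁ (proj₂ (proj₁ (proj₁ (proj₂ ω-exists))))

  ∈-∅ : ∀ {x} → ¬ (x ∈ ∅)
  ∈-∅ = proj₂ (proj₂ (proj₁ (proj₁ (proj₂ ω-exists)))) _

  ω-successor : ∀ {n} → n ∈ ω → ∃ λ s → s ∈ ω × IsSuccessor s n
  ω-successor = proj₂ (proj₁ (proj₂ ω-exists)) _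

  opaque
    ω-induction : ∀ (φ : Class 1) → Holds (∅ ∷ []) φ →
                  (∀ {n s} → n ∈ ω → IsSuccessor s n → Holds (n ∷ []) φ → Holds (s ∷ []) φ) →
                  ∀ {n} → n ∈ ω → Holds (n ∷ []) φ
    ω-induction φ base step n∈ω = proj₂ (to ∈-filter (proj₂ (proj₂ ω-exists) S S-inductive _ n∈ω))
      where
      S : V
      S = filter φ ω
      S-inductive : Inductive S
      S-inductive = (∅ , from ∈-filter (∅∈ω , base) , λ _ → ∈-∅) , λ n n∈S →
        let n∈ω , h      = to ∈-filter n∈S
            s , s∈ω , sc = ω-successor n∈ω
        in s , from ∈-filter (s∈ω , step n∈ω sc h) , sc

    -- Foundation yields an ∈-minimal counterexample, whose elements lie in `ω` by `n⊆ω` and hence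
    -- satisfy `φ`.
    ω-strong-induction : ∀ (φ : Class 1) → (∀ {n} → n ∈ ω → n ⊆ ω →
                           (∀ m → m ∈ n → Holds (m ∷ []) φ) → Holds (n ∷ []) φ) →
                         ∀ {n} → n ∈ ω → Holds (n ∷ []) φ

    n⊆ω : ∀ {n} → n ∈ ω → n ⊆ ω
    n⊆ω = ω-induction (∀∙ (v₀ ∊ v₁ ⊃ v₀ ∊ con ω)) (λ _ h → contradiction h ∈-∅)
      λ n∈ω sc n⊆ω z z∈s → [ n⊆ω z , (λ { refl → n∈ω }) ]′ (to (sc z) z∈s)

    ω-strong-induction φ step n∈ω = dne λ ¬φn →
      let m , m∈ , min   = foundation (filter (∼ φ) ω) (_ , from ∈-filter (n∈ω , ¬φn))
          m∈ω , ¬φm      = to ∈-filter m∈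
      in ¬φm (step m∈ω (n⊆ω m∈ω) λ k k∈m →
           dne λ ¬φk → min k (from ∈-filter (n⊆ω m∈ω k k∈m , ¬φk)) k∈m)

    n-transitive : ∀ {n} → n ∈ ω → ∀ m → m ∈ n → m ⊆ n
    n-transitive = ω-induction (∀∙ (v₀ ∊ v₁ ⊃ ∀∙ (v₀ ∊ v₁ ⊃ v₀ ∊ v₂)))
      (λ _ h → contradiction h ∈-∅)
      λ n∈ω sc n-trans m m∈s z z∈m → from (sc z) (inj₁
        ([ (λ m∈n → n-trans m m∈n z z∈m) , (λ { refl → z∈m }) ]′ (to (sc m) m∈s)))

    -- Strong induction on x and, inside it, on y. If x and y are incomparable, the induction
    -- hypotheses and transitivity make each a subset of the other, so they are equal.
    ω-compare : ∀ {x} → x ∈ ω → ∀ y → y ∈ ω → x ∈ y ⊎ x ≡ y ⊎ y ∈ x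
    ω-compare = ω-strong-induction (∀∙ (v₀ ∊ con ω ⊃ v₁ ∊ v₀ ∨ v₁ ≃ v₀ ∨ v₀ ∊ v₁))
      λ {x} x∈ω x⊆ω ih-x _ → ω-strong-induction (con x ∊ v₀ ∨ con x ≃ v₀ ∨ v₀ ∊ con x)
      λ {y} y∈ω y⊆ω ih-y → dne λ ¬xy →
        let x⊆y : x ⊆ y
            x⊆y z z∈x = [ id , [ (λ { refl → ⊥-elim (¬xy (inj₂ (inj₂ z∈x))) })
                               , (λ y∈z → ⊥-elim (¬xy (inj₂ (inj₂ (n-transitive x∈ω z z∈x y y∈z))))) ]′ ]′
                          (ih-x z z∈x y y∈ω)
            y⊆x : y ⊆ x
            y⊆x z z∈y = [ (λ x∈z → ⊥-elim (¬xy (inj₁ (n-transitive y∈ω z z∈y x x∈z))))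
                        , [ (λ { refl → ⊥-elim (¬xy (inj₁ z∈y)) }) , id ]′ ]′ (ih-y z z∈y)
        in ¬xy (inj₂ (inj₁ (extensionality x y λ z → mk⇔ (x⊆y z) (y⊆x z))))

    ω-ordinal : Ordinal ω
    ω-ordinal = (λ _ → n⊆ω) , (λ _ _ → ∈-irrefl)
              , (λ x y z _ _ z∈ω x∈y y∈z → n-transitive z∈ω y y∈z x x∈y)
              , (λ x y x∈ω → ω-compare x∈ω y)
              , λ s s⊆ω s≠∅ → let m , m∈s , min = foundation s s≠∅ in
                  m , m∈s , λ x x∈s →
                    [ inj₂ , [ inj₁ , (λ x∈m → contradiction x∈m (min x x∈s)) ]′ ]′
                    (ω-compare (s⊆ω m m∈s) x (s⊆ω x x∈s))

  opaque
    ω-join : ∀ {m n} → m ∈ ω → n ∈ ω → ∃ λ k → k ∈ ω × m ⊆ k × n ⊆ k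
    ω-join {m} {n} m∈ω n∈ω with ω-compare m∈ω n n∈ω
    ... | inj₁ m∈n        = n , n∈ω , n-transitive n∈ω m m∈n , λ _ → id
    ... | inj₂ (inj₁ m≡n) = n , n∈ω , (λ z → subst (z ∈_) m≡n) , λ _ → id
    ... | inj₂ (inj₂ n∈m) = m , m∈ω , (λ _ → id) , n-transitive m∈ω n n∈m

  -- Finiteness

  -- A choice-free substitute for finiteness that is stable under finite unions
  -- without any induction, and equivalent to it for sets of ordinals.
  Finite : V → Set ℓ
  Finite z = ∀ T → (∀ x → x ∈ z → ∃ λ m → m ∈ ω × ⟨ x , m ⟩ ∈ T) →
             ∃ λ N → N ∈ ω × (∀ x → x ∈ z → ∃ λ m → m ∈ N × ⟨ x , m ⟩ ∈ T)

  -- `Finite` as a class, so that induction on `ω` and separation can speak of it.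
  finite : ∀ {n} → Fin n → Class n
  finite i = ∀∙ (∀∙ (v₀ ∊ var (suc (suc i)) ⊃ ∃∙ (v₀ ∊ con ω ∧ ⟪ v₁ , v₀ ⟫ ∊ v₂)) ⊃
                 ∃∙ (v₀ ∊ con ω ∧ ∀∙ (v₀ ∊ var (suc (suc (suc i))) ⊃ ∃∙ (v₀ ∊ v₂ ∧ ⟪ v₁ , v₀ ⟫ ∊ v₃))))

  -- An arbitrary predicate need not define a set, so its finiteness is expressed by a finite cover.
  Thin : (V → Set ℓ) → Set ℓ
  Thin P = ∃ λ z → Finite z × (∀ x → P x → x ∈ z)

  finite-⊆ : ∀ {z z′} → z ⊆ z′ → Finite z′ → Finite z
  finite-⊆ {z} {z′} z⊆z′ fin T total with fin T′ total′
    where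
    -- Outside z the implication is vacuous, so there every value is allowed and `∅` serves as a
    -- default.
    T′ = relation (v₀ ∊ con z ⊃ ⟪ v₀ , v₁ ⟫ ∊ con T) z′ ω
    total′ : ∀ x → x ∈ z′ → ∃ λ m → m ∈ ω × ⟨ x , m ⟩ ∈ T′
    total′ x x∈z′ with em {x ∈ z}
    ... | no x∉z  = ∅ , ∅∈ω , from ∈-relation (x∈z′ , ∅∈ω , ⊥-elim ∘ x∉z)
    ... | yes x∈z with total x x∈z
    ... | m , m∈ω , h = m , m∈ω , from ∈-relation (x∈z′ , m∈ω , λ _ → h)
  ... | N , N∈ω , bound = N , N∈ω , λ x x∈z →
    let m , m∈N , h = bound x (z⊆z′ x x∈z)
    in m , m∈N , proj₂ (proj₂ (to ∈-relation h)) x∈z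

  thin-⊆ : ∀ {P Q : V → Set ℓ} → (∀ x → P x → Q x) → Thin Q → Thin P
  thin-⊆ P⊆Q (z , fin , Q⊆z) = z , fin , λ x → Q⊆z x ∘ P⊆Q x

  thin⇒finite : ∀ {z} → Thin (_∈ z) → Finite z
  thin⇒finite (z′ , fin , z⊆z′) = finite-⊆ z⊆z′ fin

  finite-∪ : ∀ {a b} → Finite a → Finite b → Finite (a ∪ b)
  finite-∪ {a} {b} fin-a fin-b T total
    with fin-a T (λ x → total x ∘ from ∈-∪ ∘ inj₁) | fin-b T (λ x → total x ∘ from ∈-∪ ∘ inj₂)
  ... | M , M∈ω , bound-a | N , N∈ω , bound-b with ω-join M∈ω N∈ω
  ... | K , K∈ω , M⊆K , N⊆K = K , K∈ω , λ x → [ below M⊆K bound-a x , below N⊆K bound-b x ]′ ∘ to ∈-∪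
    where
    below : ∀ {c L} → L ⊆ K → (∀ x → x ∈ c → ∃ λ m → m ∈ L × ⟨ x , m ⟩ ∈ T) →
            ∀ x → x ∈ c → ∃ λ m → m ∈ K × ⟨ x , m ⟩ ∈ T
    below L⊆K bound x x∈c = let m , m∈L , h = bound x x∈c in m , L⊆K m m∈L , h

  thin-⊎ : ∀ {P Q} → Thin P → Thin Q → Thin (λ x → P x ⊎ Q x)
  thin-⊎ (a , fin-a , P⊆a) (b , fin-b , Q⊆b) =
    a ∪ b , finite-∪ fin-a fin-b , λ x → from ∈-∪ ∘ [ inj₁ ∘ P⊆a x , inj₂ ∘ Q⊆b x ]′

  finite-singleton : ∀ {a} → Finite (pair a a)
  finite-singleton {a} T total with total a ∈-pairˡ
  ... | m , m∈ω , h with ω-successor m∈ω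
  ... | s , s∈ω , sc = s , s∈ω , λ x x∈ →
    m , from (sc m) (inj₂ refl) , subst (λ y → ⟨ y , m ⟩ ∈ T) (sym (∈-singleton⁻ x∈)) h

  ∈ω⇒finite : ∀ {n} → n ∈ ω → Finite n
  ∈ω⇒finite = ω-induction (finite 0F)
    (λ T _ → ∅ , ∅∈ω , λ x x∈∅ → contradiction x∈∅ ∈-∅)
    λ {n} n∈ω sc fin → finite-⊆
      (λ z z∈s → from ∈-∪ ([ inj₁ , (λ { refl → inj₂ ∈-pairˡ }) ]′ (to (sc z) z∈s)))
      (finite-∪ fin (finite-singleton {n}))

  -- No bounds are chosen for the fibres: `T′` relates i to every n that bounds `T` on the fibre
  -- over i, and finiteness of `I` applied to `T′` gives a common bound. `X` serves to make the
  -- union a set.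
  thin-⋃ : ∀ {I R X} → Finite I → (∀ {x i} → ⟨ x , i ⟩ ∈ R → x ∈ X) →
           (∀ i → i ∈ I → Thin (λ x → ⟨ x , i ⟩ ∈ R)) →
           Thin (λ x → ∃ λ i → i ∈ I × ⟨ x , i ⟩ ∈ R)
  thin-⋃ {I} {R} {X} fin-I dom thin =
    z , fin-z , λ { x (i , i∈I , h) → from ∈-filter (dom h , i , i∈I , h) }
    where
    z = filter (∃∙ (v₀ ∊ con I ∧ ⟪ v₁ , v₀ ⟫ ∊ con R)) X
    fin-z : Finite z
    fin-z T total with fin-I T′ total′
      where
      T′ = relation (∀∙ (⟪ v₀ , v₁ ⟫ ∊ con R ⊃ ∃∙ (v₀ ∊ v₃ ∧ ⟪ v₁ , v₀ ⟫ ∊ con T))) I ω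
      total′ : ∀ i → i ∈ I → ∃ λ n → n ∈ ω × ⟨ i , n ⟩ ∈ T′
      total′ i i∈I with thin i i∈I
      ... | c , fin-c , fibre⊆c with finite-⊆ {filter (⟪ v₀ , con i ⟫ ∊ con R) c} (λ _ → proj₁ ∘ to ∈-filter) fin-c T
                (λ x x∈ → let h = proj₂ (to ∈-filter x∈) in total x (from ∈-filter (dom h , i , i∈I , h)))
      ... | N , N∈ω , bound = N , N∈ω , from ∈-relation
        (i∈I , N∈ω , λ x h → bound x (from ∈-filter (fibre⊆c x h , h)))
    ... | N , N∈ω , bound = N , N∈ω , λ x x∈z →
      let _ , i , i∈I , h = to ∈-filter x∈z
          n , n∈N , below = bound i i∈I
          m , m∈n , t     = proj₂ (proj₂ (to ∈-relation below)) x h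
      in m , n-transitive N∈ω n n∈N m m∈n , t

  -- By injectivity the fibres of `R` in z are empty or singletons, and finitely many of them cover
  -- z.
  finite-injective : ∀ {I R z} → Finite I → (∀ x → x ∈ z → ∃ λ i → i ∈ I × ⟨ x , i ⟩ ∈ R) →
                     (∀ x x′ i → ⟨ x , i ⟩ ∈ R → ⟨ x′ , i ⟩ ∈ R → x ≡ x′) → Finite z
  finite-injective {I} {R} {z} fin total inj = thin⇒finite (cover , fin-cover , λ x x∈z →
    let i , i∈I , h = total x x∈z in z⊆cover x (i , i∈I , from ∈-relation (x∈z , i∈I , h)))
    where
    R′ = relation (⟪ v₀ , v₁ ⟫ ∊ con R) z I
    fibre : ∀ i → i ∈ I → Thin (λ x → ⟨ x , i ⟩ ∈ R′)
    fibre i i∈I with em {∃ λ x → ⟨ x , i ⟩ ∈ R′}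
    ... | no ∄x = ∅ , ∈ω⇒finite ∅∈ω , λ x h → ⊥-elim (∄x (x , h))
    ... | yes (x , h) = pair x x , finite-singleton , λ x′ h′ →
      from ∈-pair (inj₁ (inj x′ x i (proj₂ (proj₂ (to ∈-relation h′))) (proj₂ (proj₂ (to ∈-relation h)))))
    covered = thin-⋃ fin (proj₁ ∘ to ∈-relation) fibre
    cover = proj₁ covered
    fin-cover = proj₁ (proj₂ covered)
    z⊆cover = proj₂ (proj₂ covered)

  -- Ranks

  opaque
    -- Keeps the ∈-minimal values of a relation. For values in an ordinal this is a definable
    -- selection, which takes the place of choice.
    least : V → V
    least D = filter (∀∙ (∀∙ (v₂ ≃ ⟪ v₁ , v₀ ⟫ ⊃ ∀∙ (v₀ ∊ v₁ ⊃ ∼ ⟪ v₂ , v₀ ⟫ ∊ con D)))) D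

    least⊆ : ∀ {D} → least D ⊆ D
    least⊆ p = proj₁ ∘ to ∈-filter

    ∈-least : ∀ {D x y} → (⟨ x , y ⟩ ∈ least D) ⇔ (⟨ x , y ⟩ ∈ D × (∀ z → z ∈ y → ¬ (⟨ x , z ⟩ ∈ D)))
    ∈-least {D} {x} {y} = mk⇔
      (λ h → let p , q = to ∈-filter h in p , q x y refl)
      λ { (p , q) → from ∈-filter (p , λ x′ y′ e → unpack (⟨⟩-injective e) q) }
      where
      unpack : ∀ {x′ y′} → x ≡ x′ × y ≡ y′ → (∀ z → z ∈ y → ¬ (⟨ x , z ⟩ ∈ D)) →
               ∀ z → z ∈ y′ → ¬ (⟨ x′ , z ⟩ ∈ D)
      unpack (refl , refl) q = q

  -- Foundation supplies a minimal value, and comparability in the ordinal makes it unique.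
  least-isFunction : ∀ {D K μ} → Ordinal μ → IsRelation D K μ →
                     (∀ x → x ∈ K → ∃ λ y → ⟨ x , y ⟩ ∈ D) → IsFunction (least D) K (_∈ μ)
  least-isFunction {D} {K} {μ} ord rel total = (λ p → rel p ∘ least⊆ p) , value
    where
    value : ∀ x → x ∈ K → ∃ λ y → ⟨ x , y ⟩ ∈ least D × (∀ z → ⟨ x , z ⟩ ∈ least D → z ≡ y)
    value x x∈K with total x x∈K
    ... | y₀ , xy₀∈D with foundation (filter (⟪ con x , v₀ ⟫ ∊ con D) μ)
                            (y₀ , from ∈-filter (codomain rel xy₀∈D , xy₀∈D))
    ... | y , y∈ , min with to ∈-filter y∈
    ... | y∈μ , xy∈D = y , from ∈-least (xy∈D , not-below) , unique
      where
      not-below : ∀ z → z ∈ y → ¬ (⟨ x , z ⟩ ∈ D)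
      not-below z z∈y h = min z (from ∈-filter (codomain rel h , h)) z∈y
      unique : ∀ z → ⟨ x , z ⟩ ∈ least D → z ≡ y
      unique z h with to ∈-least h
      ... | xz∈D , not-below-z with compare ord (codomain rel xz∈D) y∈μ
      ... | inj₁ z∈y        = ⊥-elim (not-below z z∈y xz∈D)
      ... | inj₂ (inj₁ z≡y) = z≡y
      ... | inj₂ (inj₂ y∈z) = ⊥-elim (not-below-z y y∈z xy∈D)

  module _ {f a b} (fun : IsFunction f a (_∈ b)) where

    function-unique : ∀ {x y z} → ⟨ x , y ⟩ ∈ f → ⟨ x , z ⟩ ∈ f → y ≡ z
    function-unique {x} {y} {z} xy∈f xz∈f with proj₂ fun x (domain (proj₁ fun) xy∈f)
    ... | _ , _ , unique = trans (unique y xy∈f) (sym (unique z xz∈f))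

  -- Well-founded relations and lexicographic combinations

  WellFounded : V → (V → V → Set ℓ) → Set ℓ
  WellFounded K _≺_ = ∀ s → s ⊆ K → (∃ λ x → x ∈ s) → ∃ λ m → m ∈ s × (∀ x → x ∈ s → ¬ (x ≺ m))

  membership : V → V
  membership K = relation (v₀ ∊ v₁) K K

  membership-wellFounded : ∀ {K} → WellFounded K (λ x y → ⟨ x , y ⟩ ∈ membership K)
  membership-wellFounded s _ s≠∅ with foundation s s≠∅
  ... | m , m∈s , min = m , m∈s , λ x x∈s → min x x∈s ∘ proj₂ ∘ proj₂ ∘ to ∈-relation

  -- The first component, comparison of keys, is restricted to Q.
  opaque
    lex : V → V → V → V → V
    lex K key Q R = relation
      (∃∙ (∃∙ (⟪ v₂ , v₁ ⟫ ∊ con key ∧ ⟪ v₃ , v₀ ⟫ ∊ con key ∧ v₁ ∊ v₀ ∧ ⟪ v₂ , v₃ ⟫ ∊ con Q))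
       ∨ ∃∙ (⟪ v₁ , v₀ ⟫ ∊ con key ∧ ⟪ v₂ , v₀ ⟫ ∊ con key ∧ ⟪ v₁ , v₂ ⟫ ∊ con R)) K K

    lex-isRelation : ∀ {K key Q R} → IsRelation (lex K key Q R) K K
    lex-isRelation = relation-isRelation

  module Lexicographic {K μ key} (Q R : V) (fun : IsFunction key K (_∈ μ)) where

    opaque
      unfolding lex

      lex-< : ∀ {x y j k} → ⟨ x , j ⟩ ∈ key → ⟨ y , k ⟩ ∈ key → j ∈ k → ⟨ x , y ⟩ ∈ Q →
              ⟨ x , y ⟩ ∈ lex K key Q R
      lex-< xj yk j∈k xQy = from ∈-relation
        (domain (proj₁ fun) xj , domain (proj₁ fun) yk , inj₁ (_ , _ , xj , yk , j∈k , xQy))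

      lex-≡ : ∀ {x y k} → ⟨ x , k ⟩ ∈ key → ⟨ y , k ⟩ ∈ key → ⟨ x , y ⟩ ∈ R →
              ⟨ x , y ⟩ ∈ lex K key Q R
      lex-≡ xk yk xRy = from ∈-relation
        (domain (proj₁ fun) xk , domain (proj₁ fun) yk , inj₂ (_ , xk , yk , xRy))

      lex⁻¹ : ∀ {x y k} → ⟨ x , y ⟩ ∈ lex K key Q R → ⟨ y , k ⟩ ∈ key →
              (∃ λ j → ⟨ x , j ⟩ ∈ key × j ∈ k × ⟨ x , y ⟩ ∈ Q) ⊎ (⟨ x , k ⟩ ∈ key × ⟨ x , y ⟩ ∈ R)
      lex⁻¹ h yk with proj₂ (proj₂ (to ∈-relation h))
      ... | inj₁ (j , k′ , xj , yk′ , j∈k′ , xQy) with refl ← function-unique fun yk yk′ =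
        inj₁ (j , xj , j∈k′ , xQy)
      ... | inj₂ (k′ , xk′ , yk′ , xRy) with refl ← function-unique fun yk yk′ = inj₂ (xk′ , xRy)

      -- Foundation gives an ∈-minimal key among those attained on s, and `R` gives a minimal point
      -- among the points of s with that key.
      lex-wellFounded : WellFounded K (λ x y → ⟨ x , y ⟩ ∈ R) →
                        WellFounded K (λ x y → ⟨ x , y ⟩ ∈ lex K key Q R)
      lex-wellFounded wf s s⊆K (x₀ , x₀∈s) with proj₂ fun x₀ (s⊆K x₀ x₀∈s)
      ... | k₀ , x₀k₀ , _
        with foundation (filter (∃∙ (v₀ ∊ con s ∧ ⟪ v₀ , v₁ ⟫ ∊ con key)) μ)
               (k₀ , from ∈-filter (codomain (proj₁ fun) x₀k₀ , x₀ , x₀∈s , x₀k₀))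
      ... | k , k∈ , k-min with to ∈-filter k∈
      ... | _ , x₁ , x₁∈s , x₁k
        with wf (filter (⟪ v₀ , con k ⟫ ∊ con key) s) (λ x → s⊆K x ∘ proj₁ ∘ to ∈-filter)
               (x₁ , from ∈-filter (x₁∈s , x₁k))
      ... | m , m∈ , m-min with to ∈-filter m∈
      ... | m∈s , mk = m , m∈s , minimal
        where
        minimal : ∀ x → x ∈ s → ¬ (⟨ x , m ⟩ ∈ lex K key Q R)
        minimal x x∈s h with lex⁻¹ h mk
        ... | inj₁ (j , xj , j∈k , _) =
          k-min j (from ∈-filter (codomain (proj₁ fun) xj , x , x∈s , xj)) j∈k
        ... | inj₂ (xk , xRm) = m-min x (from ∈-filter (x∈s , xk)) xRm

    opaque
      lex-total : ∀ {x y} → Ordinal μ → x ∈ K → y ∈ K → ⟨ x , y ⟩ ∈ Q → ⟨ y , x ⟩ ∈ Q →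
                  ⟨ x , y ⟩ ∈ R ⊎ ⟨ y , x ⟩ ∈ R →
                  ⟨ x , y ⟩ ∈ lex K key Q R ⊎ ⟨ y , x ⟩ ∈ lex K key Q R
      lex-total {x} {y} ord x∈K y∈K xQy yQx R-total with proj₂ fun x x∈K | proj₂ fun y y∈K
      ... | j , xj , _ | k , yk , _ with compare ord (codomain (proj₁ fun) xj) (codomain (proj₁ fun) yk)
      ... | inj₁ j∈k        = inj₁ (lex-< xj yk j∈k xQy)
      ... | inj₂ (inj₂ k∈j) = inj₂ (lex-< yk xj k∈j yQx)
      ... | inj₂ (inj₁ refl) with R-total
      ... | inj₁ xRy = inj₁ (lex-≡ xj yk xRy)
      ... | inj₂ yRx = inj₂ (lex-≡ yk xj yRx)

  -- Ranks with values in ω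

  record Ranking (K : V) (G : V) : Set ℓ where
    field
      rank       : V
      isFunction : IsFunction rank K (_∈ ω)
      increasing : ∀ {α β a b} → ⟨ α , β ⟩ ∈ G → ⟨ α , a ⟩ ∈ rank → ⟨ β , b ⟩ ∈ rank → a ∈ b
      -- No value is skipped, so the ranks form an initial segment of `ω`. This is what later makes
      -- every colour occur.
      initial    : ∀ {β b k} → ⟨ β , b ⟩ ∈ rank → k ∈ b → ∃ λ α → ⟨ α , k ⟩ ∈ rank

    rank∈ω : ∀ {x n} → ⟨ x , n ⟩ ∈ rank → n ∈ ω
    rank∈ω = codomain (proj₁ isFunction)

  -- Well-foundedness shows that every point has some bound in `ω`, and the rank is the least bound.
  ranking : ∀ {K G} → IsRelation G K K → WellFounded K (λ α β → ⟨ α , β ⟩ ∈ G) →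
            (∀ β → β ∈ K → Thin (λ α → ⟨ α , β ⟩ ∈ G)) → Ranking K G
  ranking {K} {G} G-rel wf thin = record
    { rank = least T
    ; isFunction = function
    ; increasing = increasing
    ; initial = initial
    }
    where
    Φ : V → V → Set ℓ
    Φ S p = ∃ λ β → ∃ λ n → p ≡ ⟨ β , n ⟩ × (∀ α → ⟨ α , β ⟩ ∈ G → ∃ λ m → m ∈ n × ⟨ α , m ⟩ ∈ S)

    Φ-monotone : ∀ {S S′ p} → S ⊆ S′ → Φ S p → Φ S′ p
    Φ-monotone S⊆S′ (β , n , e , h) =
      β , n , e , λ α αGβ → let m , m∈n , αm = h α αGβ in m , m∈n , S⊆S′ _ αm

    open LeastFixedPoint (K ⊗ ω) Φ
      (∃∙ (∃∙ (v₂ ≃ ⟪ v₁ , v₀ ⟫ ∧ ∀∙ (⟪ v₀ , v₂ ⟫ ∊ con G ⊃ ∃∙ (v₀ ∊ v₂ ∧ ⟪ v₁ , v₀ ⟫ ∊ v₅)))))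
      (λ S p x → mk⇔ id id) Φ-monotone
      -- T relates β to all bounds on its rank; as a least fixed point it is
      -- defined without recursion along G.
      renaming (lfp to T)

    T-rel : IsRelation T K ω
    T-rel p = relation-isRelation p ∘ lfp⊆ p

    T-intro : ∀ {β n} → β ∈ K → n ∈ ω → (∀ α → ⟨ α , β ⟩ ∈ G → ∃ λ m → m ∈ n × ⟨ α , m ⟩ ∈ T) →
              ⟨ β , n ⟩ ∈ T
    T-intro β∈K n∈ω h = lfp-closed (∈-⊗ β∈K n∈ω) (_ , _ , refl , h)

    T-elim : ∀ {β n} → ⟨ β , n ⟩ ∈ T → ∀ α → ⟨ α , β ⟩ ∈ G → ∃ λ m → m ∈ n × ⟨ α , m ⟩ ∈ T
    T-elim βn∈T with lfp-unfold βn∈T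
    ... | _ , _ , e , h with refl , refl ← ⟨⟩-injective e = h

    -- Finiteness of the predecessors is applied to the relation `T` itself: each predecessor has
    -- some bound, so all of them have bounds below a single N. The cover is first cut down to the
    -- true predecessors, as only these are known to have bounds.
    T-step : ∀ {β} → β ∈ K → (∀ α → ⟨ α , β ⟩ ∈ G → ∃ λ n → ⟨ α , n ⟩ ∈ T) → ∃ λ n → ⟨ β , n ⟩ ∈ T
    T-step {β} β∈K ranked = proj₁ bound , T-intro β∈K (proj₁ (proj₂ bound)) λ α αGβ →
      proj₂ (proj₂ bound) α (from ∈-filter (preds⊆z α αGβ , αGβ))
      where
      z = proj₁ (thin β β∈K)
      preds⊆z = proj₂ (proj₂ (thin β β∈K))

      below : V
      below = filter (⟪ v₀ , con β ⟫ ∊ con G) z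

      total : ∀ α → α ∈ below → ∃ λ n → n ∈ ω × ⟨ α , n ⟩ ∈ T
      total α α∈ = let n , αn∈T = ranked α (proj₂ (to ∈-filter α∈)) in n , codomain T-rel αn∈T , αn∈T

      bound : ∃ λ N → N ∈ ω × (∀ α → α ∈ below → ∃ λ m → m ∈ N × ⟨ α , m ⟩ ∈ T)
      bound = finite-⊆ {below} (λ _ → proj₁ ∘ to ∈-filter) (proj₁ (proj₂ (thin β β∈K))) T total

    T-total : ∀ β → β ∈ K → ∃ λ n → ⟨ β , n ⟩ ∈ T
    T-total β β∈K = dne λ β-unranked → no-minimal
        (wf unranked (λ _ → proj₁ ∘ to ∈-filter) (β , from ∈-filter (β∈K , β-unranked)))
      where
      unranked : V
      unranked = filter (∼ ∃∙ (⟪ v₁ , v₀ ⟫ ∊ con T)) K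

      no-minimal : ¬ (∃ λ m → m ∈ unranked × (∀ x → x ∈ unranked → ¬ (⟨ x , m ⟩ ∈ G)))
      no-minimal (m , m∈ , min) = proj₂ (to ∈-filter m∈) (T-step (proj₁ (to ∈-filter m∈)) λ α αGm →
        dne λ α-unranked → min α (from ∈-filter (domain G-rel αGm , α-unranked)) αGm)

    opaque
      function : IsFunction (least T) K (_∈ ω)
      function = least-isFunction ω-ordinal T-rel T-total

    ≤-witness : ∀ {α a m n} → ⟨ α , a ⟩ ∈ least T → ⟨ α , m ⟩ ∈ T → m ∈ n → n ∈ ω → a ∈ n
    ≤-witness {a = a} {m} {n} αa αm m∈n n∈ω with to ∈-least αa
    ... | αa∈T , a-least with ω-compare (codomain T-rel αa∈T) m (n⊆ω n∈ω m m∈n)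
    ... | inj₁ a∈m         = n-transitive n∈ω m m∈n a a∈m
    ... | inj₂ (inj₁ refl) = m∈n
    ... | inj₂ (inj₂ m∈a)  = ⊥-elim (a-least m m∈a αm)

    increasing : ∀ {α β a b} → ⟨ α , β ⟩ ∈ G → ⟨ α , a ⟩ ∈ least T → ⟨ β , b ⟩ ∈ least T → a ∈ b
    increasing {α} αGβ αa βb with T-elim (proj₁ (to ∈-least βb)) α αGβ
    ... | m , m∈b , αm = ≤-witness αa αm m∈b (codomain (proj₁ function) βb)

    -- If k is omitted, take an ∈-minimal attained value n above k, say the rank of γ. The
    -- predecessors of γ have ranks below n, which can be neither k nor above k. So k already bounds
    -- γ, against the choice of n as its least bound.
    initial : ∀ {β b k} → ⟨ β , b ⟩ ∈ least T → k ∈ b → ∃ λ α → ⟨ α , k ⟩ ∈ least T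
    initial {β} {b} {k} βb k∈b = dne λ omitted → no-minimal omitted
        (foundation above (b , from ∈-filter (b∈ω , k∈b , β , βb)))
      where
      b∈ω : b ∈ ω
      b∈ω = codomain (proj₁ function) βb

      above : V
      above = filter (con k ∊ v₀ ∧ ∃∙ (⟪ v₀ , v₁ ⟫ ∊ con (least T))) ω

      ranked-below : ∀ {α n} → ¬ (∃ λ γ → ⟨ γ , k ⟩ ∈ least T) → n ∈ ω →
                     (∀ a → a ∈ above → ¬ (a ∈ n)) → (∃ λ a → a ∈ n × ⟨ α , a ⟩ ∈ least T) →
                     ∃ λ a → a ∈ k × ⟨ α , a ⟩ ∈ T
      ranked-below {α} {n} omitted n∈ω min (a , a∈n , αa)
        with ω-compare (n⊆ω n∈ω a a∈n) k (n⊆ω b∈ω k k∈b)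
      ... | inj₁ a∈k         = a , a∈k , least⊆ _ αa
      ... | inj₂ (inj₁ refl) = ⊥-elim (omitted (α , αa))
      ... | inj₂ (inj₂ k∈a)  = ⊥-elim (min a (from ∈-filter (n⊆ω n∈ω a a∈n , k∈a , α , αa)) a∈n)

      ranked : ∀ {α γ n} → ⟨ α , γ ⟩ ∈ G → ⟨ γ , n ⟩ ∈ least T → ∃ λ a → a ∈ n × ⟨ α , a ⟩ ∈ least T
      ranked {α} αGγ γn with proj₂ function α (domain G-rel αGγ)
      ... | a , αa , _ = a , increasing αGγ αa γn , αa

      no-minimal : ¬ (∃ λ γ → ⟨ γ , k ⟩ ∈ least T) →
                   ¬ (∃ λ n → n ∈ above × (∀ a → a ∈ above → ¬ (a ∈ n)))
      no-minimal omitted (n , n∈ , min) with to ∈-filter n∈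
      ... | n∈ω , k∈n , γ , γn = proj₂ (to ∈-least γn) k k∈n
        (T-intro (domain (proj₁ function) γn) (n⊆ω b∈ω k k∈b) λ α αGγ →
          ranked-below omitted n∈ω min (ranked αGγ γn))

  ranking-injection : ∀ {K G} (R : Ranking K G) →
    (∀ α β → α ∈ K → β ∈ K → α ≢ β → ⟨ α , β ⟩ ∈ G ⊎ ⟨ β , α ⟩ ∈ G) →
    IsInjection (Ranking.rank R) K ω
  ranking-injection {K} R total = isFunction , λ α β n αn βn → dne λ α≢β →
    [ (λ αGβ → ∈-irrefl (increasing αGβ αn βn)) , (λ βGα → ∈-irrefl (increasing βGα βn αn)) ]′
    (total α β (domain (proj₁ isFunction) αn) (domain (proj₁ isFunction) βn) α≢β)
    where open Ranking R

  -- Sets of ordinals ordered by membership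

  membership-total : ∀ {κ K α β} → Ordinal κ → K ⊆ κ → α ∈ K → β ∈ K → α ≢ β →
                     ⟨ α , β ⟩ ∈ membership K ⊎ ⟨ β , α ⟩ ∈ membership K
  membership-total {κ} {K} {α} {β} ord K⊆κ α∈K β∈K α≢β with compare ord (K⊆κ α α∈K) (K⊆κ β β∈K)
  ... | inj₁ α∈β        = inj₁ (from ∈-relation (α∈K , β∈K , α∈β))
  ... | inj₂ (inj₁ α≡β) = contradiction α≡β α≢β
  ... | inj₂ (inj₂ β∈α) = inj₂ (from ∈-relation (β∈K , α∈K , β∈α))

  membership-ranking : ∀ {K} → (∀ β → β ∈ K → Thin (λ α → α ∈ K × α ∈ β)) → Ranking K (membership K)
  membership-ranking thin = ranking relation-isRelation membership-wellFounded λ β β∈K →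
    thin-⊆ (λ α h → let α∈K , _ , α∈β = to ∈-relation h in α∈K , α∈β) (thin β β∈K)

  -- All ∈-predecessors lie in the finite set κ itself, so ∈ has a rank, which is injective because
  -- ∈ is total on κ.
  finite⇒countable : ∀ {κ} → Ordinal κ → Finite κ → ∃ λ f → IsInjection f κ ω
  finite⇒countable {κ} ord fin = _ , ranking-injection
    (membership-ranking λ β _ → κ , fin , λ _ → proj₁)
    (λ _ _ → membership-total ord (λ _ → id))

  -- The bijection itself, used as `T`, admits no bound N: the point sent to N would need a value in
  -- N.
  ≈ω⇒infinite : ∀ {a} → a ≈ ω → ¬ Finite a
  ≈ω⇒infinite (f , (fun , _) , surj) fin
    with fin f (λ x x∈a → let y , xy , _ = proj₂ fun x x∈a in y , codomain (proj₁ fun) xy , xy)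
  ... | N , N∈ω , bound with surj N N∈ω
  ... | x , x∈a , xN with bound x x∈a
  ... | m , m∈N , xm with refl ← function-unique fun xN xm = ∈-irrefl m∈N

  ω-cardinal : Cardinal ω
  ω-cardinal = ω-ordinal , λ α α∈ω α≈ω → ≈ω⇒infinite α≈ω (∈ω⇒finite α∈ω)

  -- If n is omitted, then by `initial` so is everything above n. All ranks on `A` would lie in n,
  -- and injectivity would make `A` finite.
  unbounded-rank : ∀ {K G} (R : Ranking K G) {A} → A ⊆ K → ¬ Finite A →
    (∀ α β n → α ∈ A → β ∈ A → ⟨ α , n ⟩ ∈ Ranking.rank R → ⟨ β , n ⟩ ∈ Ranking.rank R → α ≡ β) →
    ∀ n → n ∈ ω → ∃ λ α → ⟨ α , n ⟩ ∈ Ranking.rank R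
  unbounded-rank {K} R {A} A⊆K infinite inj n n∈ω = dne λ omitted →
    infinite (finite-injective {R = R′} (∈ω⇒finite n∈ω) (bounded omitted) R′-injective)
    where
    open Ranking R
    R′ = relation (⟪ v₀ , v₁ ⟫ ∊ con rank) A ω

    bounded : ¬ (∃ λ α → ⟨ α , n ⟩ ∈ rank) → ∀ α → α ∈ A → ∃ λ k → k ∈ n × ⟨ α , k ⟩ ∈ R′
    bounded omitted α α∈A with proj₂ isFunction α (A⊆K α α∈A)
    ... | k , αk , _ with ω-compare (rank∈ω αk) n n∈ω
    ... | inj₁ k∈n         = k , k∈n , from ∈-relation (α∈A , rank∈ω αk , αk)
    ... | inj₂ (inj₁ refl) = ⊥-elim (omitted (α , αk))
    ... | inj₂ (inj₂ n∈k)  = ⊥-elim (omitted (initial αk n∈k))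

    R′-injective : ∀ α β k → ⟨ α , k ⟩ ∈ R′ → ⟨ β , k ⟩ ∈ R′ → α ≡ β
    R′-injective α β k αk βk =
      let α∈A , _ , αk′ = to ∈-relation αk
          β∈A , _ , βk′ = to ∈-relation βk
      in inj α β k α∈A β∈A αk′ βk′

  -- A consists of the first ω elements of X.
  infinite-subset : ∀ {κ X} → Ordinal κ → X ⊆ κ → ¬ Finite X →
    ∃ λ A → A ⊆ X × A ≈ ω × (∀ β → β ∈ A → Thin (λ α → α ∈ A × α ∈ β))
  infinite-subset {κ} {X} ord X⊆κ infinite = A , A⊆X , (rank , injection , surjective) , thin-A
    where
    A : V
    -- A point enters `A` when its predecessors in X have a finite cover.
    A = filter (∃∙ (finite 0F ∧ ∀∙ (v₀ ∊ con X ∧ v₀ ∊ v₂ ⊃ v₀ ∊ v₁))) X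

    A⊆X : A ⊆ X
    A⊆X _ = proj₁ ∘ to ∈-filter

    thin-A : ∀ β → β ∈ A → Thin (λ α → α ∈ A × α ∈ β)
    thin-A β β∈A with to ∈-filter β∈A
    ... | _ , thin = thin-⊆ (λ { α (α∈A , α∈β) → A⊆X α α∈A , α∈β }) thin

    -- If `A` is finite, an ∈-minimal point of X outside `A` has all its predecessors from X in `A`,
    -- so it belongs to `A` after all. Then `A` exhausts X, which is infinite.
    A-infinite : ¬ Finite A
    A-infinite fin = infinite (finite-⊆ X⊆A fin)
      where
      X⊆A : X ⊆ A
      X⊆A x x∈X = dne λ x∉A → no-minimal
        (foundation (filter (∼ v₀ ∊ con A) X) (x , from ∈-filter (x∈X , x∉A)))
        where
        no-minimal : ¬ (∃ λ m → m ∈ filter (∼ v₀ ∊ con A) X ×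
                        (∀ y → y ∈ filter (∼ v₀ ∊ con A) X → ¬ (y ∈ m)))
        no-minimal (m , m∈ , min) = proj₂ (to ∈-filter m∈) (from ∈-filter
          (proj₁ (to ∈-filter m∈) , A , fin , λ { y (y∈X , y∈m) →
            dne λ y∉A → min y (from ∈-filter (y∈X , y∉A)) y∈m }))

    R : Ranking A (membership A)
    R = membership-ranking thin-A
    open Ranking R

    injection : IsInjection rank A ω
    injection = ranking-injection R λ _ _ → membership-total ord (λ x → X⊆κ x ∘ A⊆X x)

    surjective : ∀ n → n ∈ ω → ∃ λ α → α ∈ A × ⟨ α , n ⟩ ∈ rank
    surjective n n∈ω =
      let α , αn = unbounded-rank R (λ _ → id) A-infinite (λ α β k _ _ → proj₂ injection α β k) n n∈ω
      in α , domain (proj₁ isFunction) αn , αn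

  -- The graph of a relation with finite predecessor sets

  module Colouring {κ E} (ord : Ordinal κ) (E-rel : IsRelation E κ κ)
    (thin-E : ∀ β → β ∈ κ → Thin (λ α → ⟨ α , β ⟩ ∈ E)) where

    private
      Φ : V → V → Set ℓ
      Φ S p = ∃ λ ξ → ∃ λ n → ∃ λ α → p ≡ ⟨ ξ , ⟨ n , α ⟩ ⟩ ×
              (α ≡ ξ ⊎ ∃ λ m → ∃ λ β → m ∈ n × ⟨ ξ , ⟨ m , β ⟩ ⟩ ∈ S × ⟨ α , β ⟩ ∈ E)

      Φ-monotone : ∀ {S S′ p} → S ⊆ S′ → Φ S p → Φ S′ p
      Φ-monotone S⊆S′ (ξ , n , α , e , inj₁ α≡ξ) = ξ , n , α , e , inj₁ α≡ξ
      Φ-monotone S⊆S′ (ξ , n , α , e , inj₂ (m , β , m∈n , h , αEβ)) =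
        ξ , n , α , e , inj₂ (m , β , m∈n , S⊆S′ _ h , αEβ)

    -- ⟨ ξ , ⟨ n , α ⟩ ⟩ ∈ D iff α can be reached from ξ in at most n steps
    -- against the direction of E.
    open LeastFixedPoint (κ ⊗ (ω ⊗ κ)) Φ
      (∃∙ (∃∙ (∃∙ (v₃ ≃ ⟪ v₂ , ⟪ v₁ , v₀ ⟫ ⟫ ∧ (v₀ ≃ v₂ ∨
        ∃∙ (∃∙ (v₁ ∊ v₃ ∧ ⟪ v₄ , ⟪ v₁ , v₀ ⟫ ⟫ ∊ v₆ ∧ ⟪ v₂ , v₀ ⟫ ∊ con E)))))))
      (λ S p x → mk⇔ id id) Φ-monotone
      renaming (lfp to D)

    opaque
      D-domain : ∀ {ξ n α} → ⟨ ξ , ⟨ n , α ⟩ ⟩ ∈ D → ξ ∈ κ × n ∈ ω × α ∈ κ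
      D-domain h with to ∈-relation (lfp⊆ _ h)
      ... | ξ∈κ , nα∈ , _ with to ∈-relation nα∈
      ... | n∈ω , α∈κ , _ = ξ∈κ , n∈ω , α∈κ

      D-root : ∀ {ξ n} → ξ ∈ κ → n ∈ ω → ⟨ ξ , ⟨ n , ξ ⟩ ⟩ ∈ D
      D-root ξ∈κ n∈ω = lfp-closed (∈-⊗ ξ∈κ (∈-⊗ n∈ω ξ∈κ)) (_ , _ , _ , refl , inj₁ refl)

      D-step : ∀ {ξ n m α β} → n ∈ ω → m ∈ n → ⟨ ξ , ⟨ m , β ⟩ ⟩ ∈ D → ⟨ α , β ⟩ ∈ E →
               ⟨ ξ , ⟨ n , α ⟩ ⟩ ∈ D
      D-step n∈ω m∈n h αEβ = lfp-closed (∈-⊗ (proj₁ (D-domain h)) (∈-⊗ n∈ω (domain E-rel αEβ)))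
        (_ , _ , _ , refl , inj₂ (_ , _ , m∈n , h , αEβ))

      D⁻¹ : ∀ {ξ n α} → ⟨ ξ , ⟨ n , α ⟩ ⟩ ∈ D →
            α ≡ ξ ⊎ ∃ λ m → ∃ λ β → m ∈ n × ⟨ ξ , ⟨ m , β ⟩ ⟩ ∈ D × ⟨ α , β ⟩ ∈ E
      D⁻¹ h with lfp-unfold h
      ... | _ , _ , _ , e , r with ⟨⟩-injective e
      ... | refl , e′ with refl , refl ← ⟨⟩-injective e′ = r

      D-monotone : ∀ {ξ n m α} → n ∈ ω → m ∈ n → ⟨ ξ , ⟨ m , α ⟩ ⟩ ∈ D → ⟨ ξ , ⟨ n , α ⟩ ⟩ ∈ D
      D-monotone {n = n} {m} n∈ω m∈n h with D⁻¹ h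
      ... | inj₁ refl = D-root (proj₁ (D-domain h)) n∈ω
      ... | inj₂ (k , β , k∈m , h′ , αEβ) = D-step n∈ω (n-transitive n∈ω m m∈n k k∈m) h′ αEβ

    opaque
      -- Strong induction on n: a point reached within n steps is ξ or an E-predecessor of a point
      -- reached within some m ∈ n. Those points form a finite union of finite sets, and each has
      -- finitely many E-predecessors.
      thin-D : ∀ {ξ n} → n ∈ ω → Thin (λ α → ⟨ ξ , ⟨ n , α ⟩ ⟩ ∈ D)
      thin-D {ξ} = ω-strong-induction (∃∙ (finite 0F ∧ ∀∙ (⟪ con ξ , ⟪ v₂ , v₀ ⟫ ⟫ ∊ con D ⊃ v₀ ∊ v₁)))
        thin-step
        where
        thin-step : ∀ {n} → n ∈ ω → n ⊆ ω → (∀ m → m ∈ n → Thin (λ α → ⟨ ξ , ⟨ m , α ⟩ ⟩ ∈ D)) →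
                    Thin (λ α → ⟨ ξ , ⟨ n , α ⟩ ⟩ ∈ D)
        thin-step {n} n∈ω n⊆ω thin-below =
          thin-⊆ split (thin-⊎ (pair ξ ξ , finite-singleton , λ _ → id) new)
          where
          B : V
          B = relation (⟪ con ξ , ⟪ v₁ , v₀ ⟫ ⟫ ∊ con D) κ ω

          earlier : Thin (λ β → ∃ λ m → m ∈ n × ⟨ β , m ⟩ ∈ B)
          earlier = thin-⋃ (∈ω⇒finite n∈ω) (proj₁ ∘ to ∈-relation) λ m m∈n →
            thin-⊆ (λ β → proj₂ ∘ proj₂ ∘ to ∈-relation) (thin-below m m∈n)

          I : V
          -- The cover may contain points outside κ, to which `thin-E` does not apply.
          I = filter (v₀ ∊ con κ) (proj₁ earlier)

          new : Thin (λ α → ∃ λ β → β ∈ I × ⟨ α , β ⟩ ∈ E)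
          new = thin-⋃ (finite-⊆ (λ _ → proj₁ ∘ to ∈-filter) (proj₁ (proj₂ earlier)))
            (domain E-rel) λ β → thin-E β ∘ proj₂ ∘ to ∈-filter

          split : ∀ α → ⟨ ξ , ⟨ n , α ⟩ ⟩ ∈ D → α ∈ pair ξ ξ ⊎ ∃ λ β → β ∈ I × ⟨ α , β ⟩ ∈ E
          split α h with D⁻¹ h
          ... | inj₁ refl = inj₁ ∈-pairˡ
          ... | inj₂ (m , β , m∈n , h′ , αEβ) = inj₂ (β , from ∈-filter
            (proj₂ (proj₂ earlier) β (m , m∈n , from ∈-relation (β∈κ , n⊆ω m m∈n , h′)) , β∈κ) , αEβ)
            where
            β∈κ : β ∈ κ
            β∈κ = codomain E-rel αEβ

    -- Blocks, levels and the well-founded relation covering E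

    reach : V
    reach = relation (∃∙ (⟪ v₂ , ⟪ v₀ , v₁ ⟫ ⟫ ∊ con D)) κ κ

    opaque
      reach-intro : ∀ {ξ n α} → ⟨ ξ , ⟨ n , α ⟩ ⟩ ∈ D → ⟨ α , ξ ⟩ ∈ reach
      reach-intro h = let ξ∈κ , _ , α∈κ = D-domain h in from ∈-relation (α∈κ , ξ∈κ , _ , h)

      reach-elim : ∀ {ξ α} → ⟨ α , ξ ⟩ ∈ reach → ∃ λ n → ⟨ ξ , ⟨ n , α ⟩ ⟩ ∈ D
      reach-elim = proj₂ ∘ proj₂ ∘ to ∈-relation

    block : V
    block = least reach

    opaque
      block⊆reach : block ⊆ reach
      block⊆reach = least⊆

      block-least : ∀ {α ξ η} → ⟨ α , ξ ⟩ ∈ block → η ∈ ξ → ¬ (⟨ α , η ⟩ ∈ reach)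
      block-least αξ η∈ξ = proj₂ (to ∈-least αξ) _ η∈ξ

    opaque
      block-function : IsFunction block κ (_∈ κ)
      block-function = least-isFunction ord relation-isRelation λ α α∈κ →
        α , reach-intro (D-root α∈κ ∅∈ω)

    -- Steps are counted from the least root only, so that `level` measures the distance inside a
    -- block.
    steps : V
    steps = relation (∃∙ (⟪ v₁ , v₀ ⟫ ∊ con block ∧ ⟪ v₀ , ⟪ v₂ , v₁ ⟫ ⟫ ∊ con D)) κ ω

    level : V
    level = least steps

    opaque
      level-function : IsFunction level κ (_∈ ω)
      level-function = least-isFunction ω-ordinal relation-isRelation total
        where
        total : ∀ α → α ∈ κ → ∃ λ n → ⟨ α , n ⟩ ∈ steps
        total α α∈κ with proj₂ block-function α α∈κ
        ... | ξ , αξ , _ with reach-elim (block⊆reach _ αξ)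
        ... | n , h = n , from ∈-relation (α∈κ , proj₁ (proj₂ (D-domain h)) , ξ , αξ , h)

    opaque
      level⇒D : ∀ {α ξ n} → ⟨ α , ξ ⟩ ∈ block → ⟨ α , n ⟩ ∈ level → ⟨ ξ , ⟨ n , α ⟩ ⟩ ∈ D
      level⇒D αξ αn with proj₂ (proj₂ (to ∈-relation (least⊆ _ αn)))
      ... | ξ′ , αξ′ , h with refl ← function-unique block-function αξ αξ′ = h

    opaque
      -- One more step leads from β to α. Every root of β is thus a root of α, so the least root of
      -- α is at most that of β.
      reach-E : ∀ {α β ξ} → ⟨ β , ξ ⟩ ∈ reach → ⟨ α , β ⟩ ∈ E → ⟨ α , ξ ⟩ ∈ reach
      reach-E βξ αEβ with reach-elim βξ
      ... | n , h with ω-successor (proj₁ (proj₂ (D-domain h)))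
      ... | s , s∈ω , sc = reach-intro (D-step s∈ω (from (sc n) (inj₂ refl)) h αEβ)

    -- Compares arbitrary points of κ by level and then by ∈; it is `G` that applies it only within
    -- a block.
    same-block : V
    same-block = lex κ level (κ ⊗ κ) (membership κ)

    -- Across blocks only edges of `E` are kept, since the smaller blocks may together contain
    -- infinitely many points.
    G : V
    G = lex κ block E same-block

    private
      module Outer = Lexicographic E same-block block-function
      module Inner = Lexicographic (κ ⊗ κ) (membership κ) level-function

    opaque
      -- Predecessors in smaller blocks are E-predecessors. Those in the same block have level at
      -- most m, the level of β, so they are reached from the common root within m steps.
      thin-G : ∀ β → β ∈ κ → Thin (λ α → ⟨ α , β ⟩ ∈ G)
      thin-G β β∈κ with proj₂ block-function β β∈κ | proj₂ level-function β β∈κ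
      ... | ξ , βξ , _ | m , βm , _ = thin-⊆ split (thin-⊎ (thin-E β β∈κ) (thin-D m∈ω))
        where
        m∈ω : m ∈ ω
        m∈ω = codomain (proj₁ level-function) βm

        split : ∀ α → ⟨ α , β ⟩ ∈ G → ⟨ α , β ⟩ ∈ E ⊎ ⟨ ξ , ⟨ m , α ⟩ ⟩ ∈ D
        split α αGβ with Outer.lex⁻¹ αGβ βξ
        ... | inj₁ (_ , _ , _ , αEβ) = inj₁ αEβ
        ... | inj₂ (αξ , h) with Inner.lex⁻¹ h βm
        ... | inj₁ (n , αn , n∈m , _) = inj₂ (D-monotone m∈ω n∈m (level⇒D αξ αn))
        ... | inj₂ (αm , _)           = inj₂ (level⇒D αξ αm)

    opaque
      G-ranking : Ranking κ G
      G-ranking = ranking lex-isRelation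
        (Outer.lex-wellFounded (Inner.lex-wellFounded membership-wellFounded)) thin-G

    opaque
      same-block-total : ∀ {α β} → α ∈ κ → β ∈ κ → α ≢ β →
                         ⟨ α , β ⟩ ∈ same-block ⊎ ⟨ β , α ⟩ ∈ same-block
      same-block-total α∈κ β∈κ α≢β =
        Inner.lex-total ω-ordinal α∈κ β∈κ (∈-⊗ α∈κ β∈κ) (∈-⊗ β∈κ α∈κ)
          (membership-total ord (λ _ → id) α∈κ β∈κ α≢β)

    opaque
      -- By `reach-E` the block of α is not larger than that of β. If it is smaller, the edge itself
      -- belongs to `G`; if the blocks agree, any two distinct points are compared.
      E⇒G : ∀ {α β} → ⟨ α , β ⟩ ∈ E → α ≢ β → ⟨ α , β ⟩ ∈ G ⊎ ⟨ β , α ⟩ ∈ G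
      E⇒G {α} {β} αEβ α≢β
        with proj₂ block-function α (domain E-rel αEβ) | proj₂ block-function β (codomain E-rel αEβ)
      ... | ξ , αξ , _ | η , βη , _
        with compare ord (codomain (proj₁ block-function) αξ) (codomain (proj₁ block-function) βη)
      ... | inj₁ ξ∈η = inj₁ (Outer.lex-< αξ βη ξ∈η αEβ)
      ... | inj₂ (inj₂ η∈ξ) = ⊥-elim (block-least αξ η∈ξ (reach-E (block⊆reach _ βη) αEβ))
      ... | inj₂ (inj₁ refl) with same-block-total (domain E-rel αEβ) (codomain E-rel αEβ) α≢β
      ... | inj₁ h = inj₁ (Outer.lex-≡ αξ βη h)
      ... | inj₂ h = inj₂ (Outer.lex-≡ βη αξ h)

    opaque
      proper : ∀ {α β n} → ⟨ α , β ⟩ ∈ E → α ≢ β → ⟨ α , n ⟩ ∈ Ranking.rank G-ranking →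
               ¬ (⟨ β , n ⟩ ∈ Ranking.rank G-ranking)
      proper αEβ α≢β αn βn with E⇒G αEβ α≢β
      ... | inj₁ αGβ = ∈-irrefl (Ranking.increasing G-ranking αGβ αn βn)
      ... | inj₂ βGα = ∈-irrefl (Ranking.increasing G-ranking βGα βn αn)

  -- Free sets

  module SetMapping {κ F} (ord : Ordinal κ) (uncountable : Uncountable κ)
    (F-map : IsSetMapping F κ ω) where

    ≈∈ω⇒finite : ∀ {y ν} → ν ∈ ω → y ≈ ν → Finite y
    ≈∈ω⇒finite ν∈ω (f , (fun , inj) , _) = finite-injective (∈ω⇒finite ν∈ω)
      (λ x x∈y → let i , xi , _ = proj₂ fun x x∈y in i , codomain (proj₁ fun) xi , xi)
      inj

    image : ∀ {β} → β ∈ κ → ∃ λ y → ⟨ β , y ⟩ ∈ F × Finite y × (∀ z → ⟨ β , z ⟩ ∈ F → z ≡ y)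
    image {β} β∈κ with proj₂ F-map β β∈κ
    ... | y , βy , unique with proj₁ F-map _ βy
    ... | _ , _ , _ , (_ , ν , (_ , y≈ν) , ν∈ω) , e with refl , refl ← ⟨⟩-injective e =
      y , βy , ≈∈ω⇒finite ν∈ω y≈ν , unique

    opaque
      -- A finite κ would inject into `ω`, so κ is infinite and has a set of first ω points.
      countable-part : ∃ λ A → A ⊆ κ × A ≈ ω × (∀ β → β ∈ A → Thin (λ α → α ∈ A × α ∈ β))
      countable-part = infinite-subset ord (λ _ → id) (uncountable ∘ finite⇒countable ord)

    A : V
    A = proj₁ countable-part

    A⊆κ : A ⊆ κ
    A⊆κ = proj₁ (proj₂ countable-part)

    -- Joining the points of A pairwise forces a colouring to use all colours.
    E : V
    E = relation (∃∙ (⟪ v₂ , v₀ ⟫ ∊ con F ∧ v₁ ∊ v₀) ∨ v₀ ∊ con A ∧ v₁ ∊ con A ∧ v₀ ∊ v₁) κ κ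

    opaque
      -- The predecessors of β are elements of the finite set F(β) or, if β is in `A`, the finitely
      -- many points of `A` below it.
      thin-E : ∀ β → β ∈ κ → Thin (λ α → ⟨ α , β ⟩ ∈ E)
      thin-E β β∈κ with image β∈κ
      ... | y , βy , fin , unique = thin-⊆ split (thin-⊎ (y , fin , λ _ → id) thin-A)
        where
        thin-A : Thin (λ α → α ∈ A × β ∈ A × α ∈ β)
        thin-A with em {β ∈ A}
        ... | yes β∈A = thin-⊆ (λ { _ (α∈A , _ , α∈β) → α∈A , α∈β })
                               (proj₂ (proj₂ (proj₂ countable-part)) β β∈A)
        ... | no β∉A  = ∅ , ∈ω⇒finite ∅∈ω , λ { _ (_ , β∈A , _) → contradiction β∈A β∉A }

        split : ∀ α → ⟨ α , β ⟩ ∈ E → α ∈ y ⊎ (α ∈ A × β ∈ A × α ∈ β)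
        split α αEβ with proj₂ (proj₂ (to ∈-relation αEβ))
        ... | inj₂ h             = inj₂ h
        ... | inj₁ (z , βz , α∈z) = inj₁ (subst (α ∈_) (unique z βz) α∈z)

    open Colouring ord relation-isRelation thin-E using (G-ranking; proper)

    colour : V
    colour = Ranking.rank G-ranking

    colour-function : IsFunction colour κ (_∈ ω)
    colour-function = Ranking.isFunction G-ranking

    F-proper : ∀ {α β y n} → ⟨ β , y ⟩ ∈ F → α ∈ y → α ≢ β → ⟨ α , n ⟩ ∈ colour →
               ¬ (⟨ β , n ⟩ ∈ colour)
    F-proper βy α∈y α≢β αn βn = proper
      (from ∈-relation (domain (proj₁ colour-function) αn , domain (proj₁ colour-function) βn
                       , inj₁ (_ , βy , α∈y)))
      α≢β αn βn

    opaque
      A-rainbow : ∀ α β n → α ∈ A → β ∈ A → ⟨ α , n ⟩ ∈ colour → ⟨ β , n ⟩ ∈ colour → α ≡ β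
      A-rainbow α β n α∈A β∈A αn βn with compare ord (A⊆κ α α∈A) (A⊆κ β β∈A)
      ... | inj₂ (inj₁ α≡β) = α≡β
      ... | inj₁ α∈β = ⊥-elim (proper
        (from ∈-relation (A⊆κ α α∈A , A⊆κ β β∈A , inj₂ (α∈A , β∈A , α∈β)))
        (λ { refl → ∈-irrefl α∈β }) αn βn)
      ... | inj₂ (inj₂ β∈α) = ⊥-elim (proper
        (from ∈-relation (A⊆κ β β∈A , A⊆κ α α∈A , inj₂ (β∈A , α∈A , β∈α)))
        (λ { refl → ∈-irrefl β∈α }) βn αn)

      -- The infinite set `A` receives pairwise distinct colours, so no colour can be omitted.
      colour-onto : ∀ n → n ∈ ω → ∃ λ α → ⟨ α , n ⟩ ∈ colour
      colour-onto = unbounded-rank G-ranking A⊆κ (≈ω⇒infinite (proj₁ (proj₂ (proj₂ countable-part))))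
        A-rainbow

  -- Colour classes of a proper colouring

  module ProperColouring {κ F colour} (ord : Ordinal κ) (uncountable : Uncountable κ)
    (colour-function : IsFunction colour κ (_∈ ω))
    (colour-onto : ∀ n → n ∈ ω → ∃ λ α → ⟨ α , n ⟩ ∈ colour)
    (proper : ∀ {α β y n} → ⟨ β , y ⟩ ∈ F → α ∈ y → α ≢ β → ⟨ α , n ⟩ ∈ colour →
              ¬ (⟨ β , n ⟩ ∈ colour)) where

    -- Two implications instead of an equivalence, to match what the formulas in `partition` and
    -- `index` evaluate to.
    ColourClass : V → V → Set ℓ
    ColourClass X n = ∀ α → (α ∈ X → ⟨ α , n ⟩ ∈ colour) × (⟨ α , n ⟩ ∈ colour → α ∈ X)

    class : V → V
    class n = filter (⟪ v₀ , con n ⟫ ∊ con colour) κ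

    class⊆κ : ∀ {n} → class n ⊆ κ
    class⊆κ _ = proj₁ ∘ to ∈-filter

    class-isColourClass : ∀ {n} → ColourClass (class n) n
    class-isColourClass α = proj₂ ∘ to ∈-filter
                          , λ αn → from ∈-filter (domain (proj₁ colour-function) αn , αn)

    class-free : ∀ {X n} → ColourClass X n → IsFree F X
    class-free X-class α β α∈X β∈X α≢β y βy α∈y =
      proper βy α∈y α≢β (proj₁ (X-class α) α∈X) (proj₁ (X-class β) β∈X)

    opaque
      -- Otherwise the order "first by colour, then by ∈" has type ω.
      infinite-class : ∃ λ n → n ∈ ω × ¬ Finite (class n)
      infinite-class = dne λ all-finite → uncountable (_ , ranking-injection (R all-finite) total)
        where
        open Lexicographic (κ ⊗ κ) (membership κ) colour-function

        thin-lex : ¬ (∃ λ n → n ∈ ω × ¬ Finite (class n)) → ∀ β → β ∈ κ →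
                   Thin (λ α → ⟨ α , β ⟩ ∈ lex κ colour (κ ⊗ κ) (membership κ))
        thin-lex all-finite β β∈κ with proj₂ colour-function β β∈κ
        ... | m , βm , _ with ω-successor (codomain (proj₁ colour-function) βm)
        -- Predecessors of β may share its colour m, so the union runs over the successor of m.
        ... | s , s∈ω , sc = thin-⊆ bounded (thin-⋃ (∈ω⇒finite s∈ω) (domain (proj₁ colour-function))
            λ n n∈s → class n , dne (λ inf → all-finite (n , n⊆ω s∈ω n n∈s , inf))
                    , λ α → proj₂ (class-isColourClass α))
          where
          bounded : ∀ α → ⟨ α , β ⟩ ∈ lex κ colour (κ ⊗ κ) (membership κ) →
                    ∃ λ n → n ∈ s × ⟨ α , n ⟩ ∈ colour
          bounded α h with lex⁻¹ h βm
          ... | inj₁ (n , αn , n∈m , _) = n , from (sc n) (inj₁ n∈m) , αn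
          ... | inj₂ (αm , _)           = m , from (sc m) (inj₂ refl) , αm

        R : ¬ (∃ λ n → n ∈ ω × ¬ Finite (class n)) → Ranking κ (lex κ colour (κ ⊗ κ) (membership κ))
        R all-finite = ranking lex-isRelation (lex-wellFounded membership-wellFounded) (thin-lex all-finite)

        total : ∀ α β → α ∈ κ → β ∈ κ → α ≢ β →
                ⟨ α , β ⟩ ∈ lex κ colour (κ ⊗ κ) (membership κ) ⊎
                ⟨ β , α ⟩ ∈ lex κ colour (κ ⊗ κ) (membership κ)
        total α β α∈κ β∈κ α≢β = lex-total ω-ordinal α∈κ β∈κ (∈-⊗ α∈κ β∈κ) (∈-⊗ β∈κ α∈κ)
          (membership-total ord (λ _ → id) α∈κ β∈κ α≢β)

    free-within : ∀ {n} → (∃ λ B → B ⊆ class n × B ≈ ω × (∀ β → β ∈ B → Thin (λ α → α ∈ B × α ∈ β))) →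
                  ∃ λ B → B ⊆ κ × IsFree F B × HasCardinality B ω
    free-within (B , B⊆X , B≈ω , _) =
      B , (λ x → class⊆κ x ∘ B⊆X x)
        , (λ α β α∈B β∈B → class-free class-isColourClass α β (B⊆X α α∈B) (B⊆X β β∈B))
        , ω-cardinal , B≈ω

    -- The cardinality has to be exactly ω, hence the first ω points of an infinite class are taken;
    -- subsets of a class remain free.
    free : ∃ λ B → B ⊆ κ × IsFree F B × HasCardinality B ω
    free = free-within (infinite-subset ord class⊆κ (proj₂ (proj₂ infinite-class)))

    partition : V
    partition = filter (∃∙ (v₀ ∊ con ω ∧ ∀∙ ((v₀ ∊ v₂ ⊃ ⟪ v₀ , v₁ ⟫ ∊ con colour)
                                           ∧ (⟪ v₀ , v₁ ⟫ ∊ con colour ⊃ v₀ ∊ v₂)))) (𝒫 κ)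

    index : V
    index = relation (∀∙ ((v₀ ∊ v₁ ⊃ ⟪ v₀ , v₂ ⟫ ∊ con colour)
                        ∧ (⟪ v₀ , v₂ ⟫ ∊ con colour ⊃ v₀ ∊ v₁))) partition ω

    colourClass-unique : ∀ {X Y n} → ColourClass X n → ColourClass Y n → X ≡ Y
    colourClass-unique p q = extensionality _ _ λ α →
      mk⇔ (proj₂ (q α) ∘ proj₁ (p α)) (proj₂ (p α) ∘ proj₁ (q α))

    class∈partition : ∀ {n} → n ∈ ω → class n ∈ partition
    class∈partition {n} n∈ω =
      from ∈-filter (from ∈-𝒫 class⊆κ , n , n∈ω , class-isColourClass)

    -- Colour n occurs, so the class contains a point, and this point determines the colour.
    colour-unique : ∀ {X n m} → n ∈ ω → ColourClass X n → ColourClass X m → m ≡ n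
    colour-unique {n = n} n∈ω p q with colour-onto n n∈ω
    ... | α , αn = function-unique colour-function (proj₁ (q α) (proj₂ (p α) αn)) αn

    index-bijection : IsBijection index partition ω
    index-bijection = ((relation-isRelation , value) , injective) , onto
      where
      value : ∀ X → X ∈ partition → ∃ λ n → ⟨ X , n ⟩ ∈ index × (∀ m → ⟨ X , m ⟩ ∈ index → m ≡ n)
      value X X∈ with to ∈-filter X∈
      ... | _ , n , n∈ω , X-class = n , from ∈-relation (X∈ , n∈ω , X-class) , λ m Xm →
        colour-unique n∈ω X-class (proj₂ (proj₂ (to ∈-relation Xm)))

      injective : ∀ X Y n → ⟨ X , n ⟩ ∈ index → ⟨ Y , n ⟩ ∈ index → X ≡ Y
      injective X Y n Xn Yn =
        colourClass-unique (proj₂ (proj₂ (to ∈-relation Xn))) (proj₂ (proj₂ (to ∈-relation Yn)))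

      onto : ∀ n → n ∈ ω → ∃ λ X → X ∈ partition × ⟨ X , n ⟩ ∈ index
      onto n n∈ω = class n , class∈partition n∈ω
                 , from ∈-relation (class∈partition n∈ω , n∈ω , class-isColourClass)

    isPartition : IsPartition partition κ
    isPartition = nonempty , covers , disjoint
      where
      nonempty : ∀ X → X ∈ partition → X ⊆ κ × (∃ λ α → α ∈ X)
      nonempty X X∈ with to ∈-filter X∈
      ... | X∈𝒫κ , n , n∈ω , X-class with colour-onto n n∈ω
      ... | α , αn = to ∈-𝒫 X∈𝒫κ , α , proj₂ (X-class α) αn

      covers : ∀ α → α ∈ κ → ∃ λ X → X ∈ partition × α ∈ X
      covers α α∈κ with proj₂ colour-function α α∈κ
      ... | n , αn , _ = class n , class∈partition (codomain (proj₁ colour-function) αn)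
                       , from ∈-filter (α∈κ , αn)

      disjoint : ∀ X Y → X ∈ partition → Y ∈ partition → (∃ λ α → α ∈ X × α ∈ Y) → X ≡ Y
      disjoint X Y X∈ Y∈ (α , α∈X , α∈Y) with to ∈-filter X∈ | to ∈-filter Y∈
      ... | _ , n , _ , p | _ , m , _ , q
        with refl ← function-unique colour-function (proj₁ (p α) α∈X) (proj₁ (q α) α∈Y) =
        colourClass-unique p q

    freeUnion : ∃ λ P → IsPartition P κ × (∀ X → X ∈ P → IsFree F X) × HasCardinality P ω
    freeUnion = partition , isPartition
      , (λ X X∈ → let _ , _ , _ , X-class = to ∈-filter X∈ in class-free X-class)
      , ω-cardinal , index , index-bijection

theorem1p6 : ∀ {ℓ} → ExcludedMiddle ℓ → (𝓜 : ZF ℓ) →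
    let open ZF 𝓜
        open SetTheory 𝓜
    in (κ : V) → Cardinal κ → Uncountable κ → Free κ ω ω × FreeUnion κ ω ω
theorem1p6 em 𝓜 κ (ord , _) uncountable = Colours.free , Colours.freeUnion
  where
  open ZF 𝓜
  open SetTheory 𝓜
  open Sets em 𝓜

  module Colours (F : V) (F-map : IsSetMapping F κ ω) where
    open SetMapping ord uncountable F-map
    open ProperColouring {F = F} ord uncountable colour-function colour-onto F-proper public
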